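{- Let $c\geq 2$ be an integer such that $c+1$ is a prime power. Then $R_{c,c+2}=\frac{c+2}{c}$, i.e., $\lim_{q\to\infty} M_{c,c+2}(q)/q^{2}=\frac{c+2}{c}$.
   Context: For $P\subseteq F^l$ over a finite alphabet $F$, $desc(P)=\{x\in F^l: \text{for every } i\in\{1,\ldots,l\} \text{ there is } y\in P \text{ with } x_i=y_i\}$. For an integer $c\geq 2$, a $c$-frameproof code of length $l$ is a subset $C\subseteq F^l$ with $desc(P)\cap C=P$ for every $P\subseteq C$ with $|P|\leq c$; it is $q$-ary if $|F|=q$. $M_{c,l}(q)$ denotes the largest cardinality of a $q$-ary $c$-frameproof code of length $l$, and $R_{c,l}=\lim_{q\to\infty} M_{c,l}(q)/q^{\lceil l/c\rceil}$ (note $\lceil (c+2)/c\rceil=2$ for $c\geq 2$). -}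

module Defs where

open import Data.Fin using (Fin; finToFun)
import Data.Fin.Properties as Fin
open import Data.Fin.Subset using (Subset; _∈_; _⊆_; ∣_∣; ⊥)
open import Data.Fin.Subset.Properties
  using (_∈?_; _⊆?_; anySubset?; ∣p∣≤n; ∉⊥)
open import Data.Integer using (+_)
open import Data.Nat using (ℕ; zero; suc; pred; _+_; _^_; _≤_; NonZero)
import Data.Nat as ℕ
import Data.Nat.Properties as ℕ
open import Data.Nat.Primality using (Prime)
open import Data.Product using (∃; ∃₂; _×_; _,_; proj₁; proj₂)
open import Data.Rational as ℚ using (ℚ; 0ℚ)
open import Level using (0ℓ)
open import Function using (_∘_)
open import Relation.Binary.PropositionalEquality using (_≡_)
open import Relation.Nullary using (¬_; Dec; yes; no; ¬?; contradiction)
open import Relation.Nullary.Decidable using (_×-dec_; _→-dec_; map′; decidable-stable)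
open import Relation.Unary using (Pred; Decidable; _∩_; _≐_)

IsPrimePower : ℕ → Set
IsPrimePower n = ∃₂ λ p k → Prime p × 1 ≤ k × n ≡ p ^ k

⌈_/_⌉ : (m n : ℕ) .{{_ : NonZero n}} → ℕ
⌈ m / n ⌉ = (m + pred n) ℕ./ n

allSubset? : ∀ {n} {A : Pred (Subset n) 0ℓ} → Decidable A → Dec (∀ P → A P)
allSubset? A? = map′
  (λ ¬∃¬ P → decidable-stable (A? P) (λ ¬a → ¬∃¬ (P , ¬a)))
  (λ { ∀a (P , ¬a) → ¬a (∀a P) })
  (¬? (anySubset? (¬? ∘ A?)))

≐? : ∀ {n} {A B : Pred (Fin n) 0ℓ} → Decidable A → Decidable B → Dec (A ≐ B)
≐? A? B? = map′
  (λ (f , g) → (λ {x} → f x) , (λ {x} → g x))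
  (λ (f , g) → (λ x → f {x}) , (λ x → g {x}))
  (Fin.all? (λ x → A? x →-dec B? x) ×-dec Fin.all? (λ x → B? x →-dec A? x))

module _ (q l : ℕ) where

  -- Words of length l over the alphabet Fin q, numbered through the bijection finToFun / funToFin
  -- between Fin (q ^ l) and Fin l → Fin q, so that a set of words is a Subset.
  Word : Set
  Word = Fin (q ^ l)

  Code : Set
  Code = Subset (q ^ l)

  coord : Word → Fin l → Fin q
  coord = finToFun {q} {l}

  desc : Code → Pred Word 0ℓ
  desc P x = ∀ i → ∃ λ y → y ∈ P × coord x i ≡ coord y i

  IsFrameproof : ℕ → Code → Set
  IsFrameproof c C = ∀ P → P ⊆ C → ∣ P ∣ ≤ c → (desc P ∩ (_∈ C)) ≐ (_∈ P)

  IsLargestFrameproof : ℕ → Code → Set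
  IsLargestFrameproof c C =
    IsFrameproof c C × (∀ D → IsFrameproof c D → ∣ D ∣ ≤ ∣ C ∣)

  desc? : ∀ P → Decidable (desc P)
  desc? P x = Fin.all? λ i → Fin.any? λ y →
    (y ∈? P) ×-dec (coord x i Fin.≟ coord y i)

  frameproof? : ∀ c → Decidable (IsFrameproof c)
  frameproof? c C = allSubset? λ P →
    (P ⊆? C) →-dec ((∣ P ∣ ℕ.≤? c) →-dec
      ≐? (λ x → desc? P x ×-dec (x ∈? C)) (_∈? P))

  frameproof-⊥ : ∀ c → IsFrameproof c ⊥
  frameproof-⊥ c P P⊆⊥ _ =
    (λ (_ , x∈⊥) → contradiction x∈⊥ ∉⊥) , (λ x∈P → contradiction (P⊆⊥ x∈P) ∉⊥)

  largestFrameproof : ∀ c → ∃ (IsLargestFrameproof c)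
  largestFrameproof c = search (q ^ l) (λ D _ → ∣p∣≤n D)
    where
    search : ∀ n → (∀ D → IsFrameproof c D → ∣ D ∣ ≤ n) → ∃ (IsLargestFrameproof c)
    search zero bound =
      ⊥ , frameproof-⊥ c , λ D fD → ℕ.≤-trans (bound D fD) ℕ.z≤n
    search (suc n) bound
      with anySubset? (λ C → frameproof? c C ×-dec (suc n ℕ.≤? ∣ C ∣))
    ... | yes (C , fC , n<∣C∣) = C , fC , λ D fD → ℕ.≤-trans (bound D fD) n<∣C∣
    ... | no ∄C = search n λ D fD → ℕ.≮⇒≥ λ n<∣D∣ → ∄C (D , fD , n<∣D∣)

M : (c l q : ℕ) → ℕ
M c l q = ∣ proj₁ (largestFrameproof q l c) ∣

ConvergesTo : (∀ q .{{_ : NonZero q}} → ℚ) → ℚ → Set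
ConvergesTo f L = ∀ ε → 0ℚ ℚ.< ε →
  ∃ λ N → ∀ q .{{_ : NonZero q}} → N ≤ q → ℚ.∣ f q ℚ.- L ∣ ℚ.< ε

codeRatio : (c l : ℕ) .{{_ : NonZero c}} (q : ℕ) .{{_ : NonZero q}} → ℚ
codeRatio c l q = ℚ._/_ (+ M c l q) (q ^ ⌈ l / c ⌉) {{ℕ.m^n≢0 q ⌈ l / c ⌉}}

-- IsR c l r: the limit R_{c,l} exists and equals the rational r.
IsR : (c l : ℕ) .{{_ : NonZero c}} → ℚ → Set
IsR c l r = ConvergesTo (codeRatio c l) r

module Submission where

-- Upper bound.  Call a set T of coordinates own for a codeword x if no other codeword agrees with x
-- on T.  If every part of a partition of the c + 2 coordinates into c parts failed to be own, then
-- c witnesses would have x as a descendant.  At most (c + 2) q codewords own a single coordinate;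
-- for any other x the non-own pairs intersect pairwise, so they form a star or a triangle, there are
-- at most c + 1 of them, and x owns at least c (c + 1) / 2 of the pairs.  Each of the
-- (c + 2) (c + 1) / 2 pairs is owned by at most q² codewords.
--
-- Lower bound.  The lines of the affine plane of order c + 1 give (c + 1)² words of length c + 2 over
-- c + 1 letters, any two agreeing at most once.  Fix one of them, and multiply each of the other
-- c (c + 2) words letterwise with the m² words (u + j v)_j over ℤ/m, m prime to (c + 1)!, collapsing
-- every letter that agrees with the fixed word to one symbol.  At most one letter is lost, and any
-- two of the others determine the codeword; so c parents never suffice for another word.  This uses
-- c m + 1 letters, and m ≡ 1 mod (c + 1)! can be chosen with q − c m bounded.
--
-- Field of order p^k.  Put N = p^k − 1.  In A = 𝔽_p[X] / (X^N − 1), realised as operators on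
-- N-periodic sequences, a^(p^k) = a for all a.  The product of the X^(p^d) − X over 0 < d < k is
-- nonzero in A because its degree is below N, hence it is nonzero in some residue field of A.  There
-- the k conjugates of X are distinct, so 1, X, …, X^(k−1) are independent over 𝔽_p and the residue
-- field has at least p^k elements; all are roots of Y^(p^k) − Y, so it has exactly p^k.

open import Algebra.Bundles using (CommutativeRing)
open import Data.Fin as Fin using (Fin; toℕ)
import Data.Fin.Properties as Fin
open import Data.List using (List; []; _∷_)
open import Data.Nat as ℕ using (ℕ; zero; suc; pred; _<_; _≤_; _∸_; _!; NonZero; z≤n; s≤s)
import Data.Nat.DivMod as ℕ
import Data.Nat.Properties as ℕ
open import Data.Nat.Primality using (Prime; euclidsLemma; prime⇒nonZero; prime⇒nonTrivial)
open import Data.Nat.Solver using (module +-*-Solver)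
open import Data.Product using (∃; ∃₂; _×_; _,_; proj₁; proj₂; uncurry)
open import Data.Sum using (_⊎_; inj₁; inj₂)
open import Function using (_∘_; id)
open import Level using (0ℓ)
open import Relation.Binary.PropositionalEquality as ≡ using (_≡_; _≢_)
open import Relation.Nullary using (¬_; Dec; yes; no; does; ¬?; contradiction)
open import Relation.Nullary.Decidable using (_×-dec_; _⊎-dec_; decidable-stable; dec-true; map′)
open import Defs

-- Binomial coefficients modulo a prime, and the Frobenius map.

module PrimeCharacteristic where
  open import Data.Nat.Combinatorics using (_C_; nCn≡1; nCk≡n!/k![n-k]!; k![n∸k]!∣n!)
  open import Data.Nat.Divisibility as ∣ using (_∣_)
  open import Data.Fin using (inject₁; fromℕ)

  prime∣m!⇒≤ : ∀ {p} → Prime p → ∀ m → p ∣ m ! → p ≤ m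
  prime∣m!⇒≤ {p} pp zero p∣1 = contradiction (∣.∣⇒≤ p∣1) (ℕ.<⇒≱ (ℕ.nonTrivial⇒n>1 p {{prime⇒nonTrivial pp}}))
  prime∣m!⇒≤ pp (suc m) p∣ with euclidsLemma (suc m) (m !) pp p∣
  ... | inj₁ p∣m+1 = ∣.∣⇒≤ p∣m+1
  ... | inj₂ p∣m! = ℕ.m≤n⇒m≤1+n (prime∣m!⇒≤ pp m p∣m!)

  -- `p` divides `p !`, which is this coefficient times `k ! * (p ∸ k) !`, and a prime divides a
  -- factorial only if it is at most the argument.
  prime∣C : ∀ {p} → Prime p → ∀ {k} → 0 < k → k < p → p ∣ (p C k)
  prime∣C {p} pp {k} 0<k k<p with euclidsLemma (p C k) (k ! ℕ.* (p ∸ k) !) pp p∣product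
    where
    instance _ = k ℕ.!* (p ∸ k) !≢0
    product≡p! : (p C k) ℕ.* (k ! ℕ.* (p ∸ k) !) ≡ p !
    product≡p! = ≡.trans (≡.cong (ℕ._* (k ! ℕ.* (p ∸ k) !)) (nCk≡n!/k![n-k]! (ℕ.<⇒≤ k<p)))
      (ℕ.m/n*n≡m (k![n∸k]!∣n! (ℕ.<⇒≤ k<p)))
    p∣p! : ∀ q → 0 < q → q ∣ q !
    p∣p! (suc q) _ = ∣.m∣m*n (q !)
    p∣product : p ∣ (p C k) ℕ.* (k ! ℕ.* (p ∸ k) !)
    p∣product = ≡.subst (p ∣_) (≡.sym product≡p!) (p∣p! p (ℕ.<-trans 0<k k<p))
  ... | inj₁ p∣C = p∣C
  ... | inj₂ p∣k!j! with euclidsLemma (k !) ((p ∸ k) !) pp p∣k!j!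
  ... | inj₁ p∣k! = contradiction (prime∣m!⇒≤ pp k p∣k!) (ℕ.<⇒≱ k<p)
  ... | inj₂ p∣j! = contradiction (prime∣m!⇒≤ pp (p ∸ k) p∣j!) (ℕ.<⇒≱ (ℕ.∸-monoʳ-< 0<k (ℕ.<⇒≤ k<p)))

  module Frobenius (R : CommutativeRing 0ℓ 0ℓ) (p : ℕ) (pp : Prime p) where
    open CommutativeRing R renaming (zero to *-zero)
    open import Algebra.Properties.Semiring.Exp semiring public
    open import Algebra.Properties.CommutativeSemiring.Exp commutativeSemiring using (^-distrib-*) public
    open import Algebra.Properties.Semiring.Mult semiring renaming (_×_ to _×ᴿ_) public
    open import Algebra.Properties.CommutativeSemiring.Binomial commutativeSemiring
    open import Algebra.Properties.CommutativeMonoid.Sum +-commutativeMonoid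
    open import Relation.Binary.Reasoning.Setoid setoid

    1^n≈1 : ∀ n → 1# ^ n ≈ 1#
    1^n≈1 zero = refl
    1^n≈1 (suc n) = trans (*-identityˡ _) (1^n≈1 n)

    module _ (p×1≈0 : p ×ᴿ 1# ≈ 0#) where

      p∣n⇒n×x≈0 : ∀ {n} → p ∣ n → ∀ x → n ×ᴿ x ≈ 0#
      p∣n⇒n×x≈0 (∣.divides k ≡.refl) x = begin
        (k ℕ.* p) ×ᴿ x            ≈⟨ ×-congʳ (k ℕ.* p) (*-identityˡ x) ⟨
        (k ℕ.* p) ×ᴿ (1# * x)     ≈⟨ ×-assoc-* (k ℕ.* p) 1# x ⟨
        ((k ℕ.* p) ×ᴿ 1#) * x     ≈⟨ *-congʳ (×1-homo-* k p) ⟩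
        ((k ×ᴿ 1#) * (p ×ᴿ 1#)) * x ≈⟨ *-congʳ (*-congˡ p×1≈0) ⟩
        ((k ×ᴿ 1#) * 0#) * x      ≈⟨ *-congʳ (zeroʳ _) ⟩
        0# * x                   ≈⟨ zeroˡ x ⟩
        0#                       ∎

      freshman : ∀ x y → (x + y) ^ p ≈ x ^ p + y ^ p
      freshman x y = go p ≡.refl
        where
        -- `p` is a fixed parameter; the separate exponent `q` can be matched as a successor, which
        -- splits off the first and the last binomial term.
        go : ∀ q → q ≡ p → (x + y) ^ q ≈ x ^ q + y ^ q
        go zero ≡.refl = contradiction ≡.refl (ℕ.≢-nonZero⁻¹ p {{prime⇒nonZero pp}})
        go q@(suc r) ≡.refl = begin
          (x + y) ^ q
            ≈⟨ theorem q x y ⟩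
          t Fin.zero + sum (λ i → t (Fin.suc i))
            ≈⟨ +-congˡ (sum-init-last (λ i → t (Fin.suc i))) ⟩
          t Fin.zero + (sum (λ i → t (Fin.suc (inject₁ i))) + t (fromℕ q))
            ≈⟨ +-cong first (+-cong (trans (sum-cong-≋ middle) (sum-replicate-zero r)) last) ⟩
          y ^ q + (0# + x ^ q)
            ≈⟨ +-congˡ (+-identityˡ _) ⟩
          y ^ q + x ^ q
            ≈⟨ +-comm _ _ ⟩
          x ^ q + y ^ q ∎
          where
          t : Fin (suc q) → Carrier
          t = binomialTerm x y q
          first : t Fin.zero ≈ y ^ q
          first = trans (+-identityʳ _) (*-identityˡ _)
          middle : ∀ i → t (Fin.suc (inject₁ i)) ≈ 0#
          middle i = p∣n⇒n×x≈0 (prime∣C pp (s≤s z≤n)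
            (s≤s (≡.subst (_< r) (≡.sym (Fin.toℕ-inject₁ i)) (Fin.toℕ<n i)))) _
          last : t (fromℕ q) ≈ x ^ q
          last = begin
            t (fromℕ q)
              ≡⟨ ≡.cong (λ k → (q C k) ×ᴿ (x ^ k * y ^ (q ∸ k))) (Fin.toℕ-fromℕ q) ⟩
            (q C q) ×ᴿ (x ^ q * y ^ (q ∸ q))
              ≡⟨ ≡.cong₂ (λ c k → c ×ᴿ (x ^ q * y ^ k)) (nCn≡1 q) (ℕ.n∸n≡0 q) ⟩
            1 ×ᴿ (x ^ q * 1#)
              ≈⟨ trans (×-homo-1 _) (*-identityʳ _) ⟩
            x ^ q ∎

      frobenius-+ : ∀ k x y → (x + y) ^ (p ℕ.^ k) ≈ x ^ (p ℕ.^ k) + y ^ (p ℕ.^ k)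
      frobenius-+ zero x y = trans (*-identityʳ _) (sym (+-cong (*-identityʳ _) (*-identityʳ _)))
      frobenius-+ (suc k) x y = begin
        (x + y) ^ (p ℕ.* p ℕ.^ k)          ≈⟨ ^-assocʳ (x + y) p (p ℕ.^ k) ⟨
        ((x + y) ^ p) ^ (p ℕ.^ k)          ≈⟨ ^-congˡ (p ℕ.^ k) (freshman x y) ⟩
        (x ^ p + y ^ p) ^ (p ℕ.^ k)        ≈⟨ frobenius-+ k (x ^ p) (y ^ p) ⟩
        (x ^ p) ^ (p ℕ.^ k) + (y ^ p) ^ (p ℕ.^ k)
          ≈⟨ +-cong (^-assocʳ x p (p ℕ.^ k)) (^-assocʳ y p (p ℕ.^ k)) ⟩
        x ^ (p ℕ.* p ℕ.^ k) + y ^ (p ℕ.* p ℕ.^ k) ∎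

      0^p^k≈0 : ∀ k → 0# ^ (p ℕ.^ k) ≈ 0#
      0^p^k≈0 k = go (p ℕ.^ k) (ℕ.≢-nonZero⁻¹ (p ℕ.^ k) {{ℕ.m^n≢0 p k {{prime⇒nonZero pp}}}})
        where
        go : ∀ m → m ≢ 0 → 0# ^ m ≈ 0#
        go zero m≢0 = contradiction ≡.refl m≢0
        go (suc m) _ = zeroˡ _

      -- Fermat's little theorem by induction on `m`: the iterated Frobenius map is additive and
      -- fixes `1#`.
      frobenius-× : ∀ k m → (m ×ᴿ 1#) ^ (p ℕ.^ k) ≈ m ×ᴿ 1#
      frobenius-× k zero = 0^p^k≈0 k
      frobenius-× k (suc m) =
        trans (frobenius-+ k 1# (m ×ᴿ 1#)) (+-cong (1^n≈1 (p ℕ.^ k)) (frobenius-× k m))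

-- Roots of polynomials, affine lines, and a field listed as polynomials in one element.

module FiniteFields where
  open import Data.Nat.Coprimality using (coprime-Bézout; prime⇒coprime)
  open import Data.Nat.GCD using (module Bézout)
  open import Relation.Binary.Definitions using (tri<; tri≈; tri>)
  open import Data.Fin using (fromℕ; finToFun; funToFin)
  open PrimeCharacteristic

  module Polynomials (R : CommutativeRing 0ℓ 0ℓ) where
    open CommutativeRing R renaming (zero to *-zero)
    open import Algebra.Properties.Semiring.Exp semiring
    open import Algebra.Properties.Group +-group using (x∙y⁻¹≈ε⇒x≈y; x≈y⇒x∙y⁻¹≈ε; ∙-cancelˡ)
    open import Algebra.Properties.Ring ring using ([y-z]x≈yx-zx; x[y-z]≈xy-xz)
    open import Algebra.Properties.AbelianGroup +-abelianGroup using (⁻¹-∙-comm)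
    open import Algebra.Solver.Ring.NaturalCoefficients.Default commutativeSemiring public
      using (solve; _:=_; _:+_; _:*_)
    open import Relation.Binary.Reasoning.Setoid setoid

    Coefficients : ℕ → Set
    Coefficients m = Fin m → Carrier

    eval : ∀ {m} → Coefficients m → Carrier → Carrier
    eval {zero} c x = 0#
    eval {suc m} c x = c Fin.zero + x * eval (c ∘ Fin.suc) x

    eval-≈0 : ∀ {m} (c : Coefficients m) → (∀ i → c i ≈ 0#) → ∀ x → eval c x ≈ 0#
    eval-≈0 {zero} c c≈0 x = refl
    eval-≈0 {suc m} c c≈0 x = begin
      c Fin.zero + x * eval (c ∘ Fin.suc) x ≈⟨ +-cong (c≈0 _) (*-congˡ (eval-≈0 (c ∘ Fin.suc) (c≈0 ∘ Fin.suc) x)) ⟩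
      0# + x * 0#                           ≈⟨ trans (+-identityˡ _) (zeroʳ x) ⟩
      0#                                    ∎

    eval-- : ∀ {m} (c d : Coefficients m) x → eval (λ i → c i - d i) x ≈ eval c x - eval d x
    eval-- {zero} c d x = sym (-‿inverseʳ 0#)
    eval-- {suc m} c d x = begin
      c₀ - d₀ + x * eval (λ i → c (Fin.suc i) - d (Fin.suc i)) x
        ≈⟨ +-congˡ (*-congˡ (eval-- (c ∘ Fin.suc) (d ∘ Fin.suc) x)) ⟩
      c₀ - d₀ + x * (u - v)          ≈⟨ +-congˡ (x[y-z]≈xy-xz x u v) ⟩
      c₀ - d₀ + (x * u - x * v)
        ≈⟨ solve 4 (λ a b d e → a :+ b :+ (d :+ e) := a :+ d :+ (b :+ e)) refl c₀ (- d₀) (x * u) (- (x * v)) ⟩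
      c₀ + x * u + (- d₀ - x * v)    ≈⟨ +-congˡ (⁻¹-∙-comm d₀ (x * v)) ⟩
      c₀ + x * u - (d₀ + x * v)      ∎
      where
      c₀ = c Fin.zero
      d₀ = d Fin.zero
      u = eval (c ∘ Fin.suc) x
      v = eval (d ∘ Fin.suc) x

    monomial : ∀ {m} → Fin m → Coefficients m
    monomial Fin.zero Fin.zero = 1#
    monomial Fin.zero (Fin.suc i) = 0#
    monomial (Fin.suc s) Fin.zero = 0#
    monomial (Fin.suc s) (Fin.suc i) = monomial s i

    eval-monomial : ∀ {m} (s : Fin m) x → eval (monomial s) x ≈ x ^ toℕ s
    eval-monomial {suc m} Fin.zero x = trans
      (+-congˡ (trans (*-congˡ (eval-≈0 {m} (monomial Fin.zero ∘ Fin.suc) (λ _ → refl) x)) (zeroʳ x)))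
      (+-identityʳ 1#)
    eval-monomial (Fin.suc s) x = trans (+-identityˡ _) (*-congˡ (eval-monomial s x))

    -- Synthetic division by `X − a`; the remainder is `eval c a`.
    quotientBy : ∀ {m} → Carrier → Coefficients (suc m) → Coefficients m
    quotientBy {suc m} a c Fin.zero = eval (c ∘ Fin.suc) a
    quotientBy {suc m} a c (Fin.suc i) = quotientBy a (c ∘ Fin.suc) i

    -- f(x) − f(a) = (x − a) q(x), with both sides moved so that no subtraction occurs.
    eval-quotientBy : ∀ {m} a (c : Coefficients (suc m)) x →
      eval c x + a * eval (quotientBy a c) x ≈ eval c a + x * eval (quotientBy a c) x
    eval-quotientBy {zero} a c x =
      solve 4 (λ c x a z → c :+ x :* z :+ a :* z := c :+ a :* z :+ x :* z) refl (c Fin.zero) x a 0#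
    eval-quotientBy {suc m} a c x = begin
      c₀ + x * ex + a * (ea + x * Q)   ≈⟨ solve 6 (λ c₀ x ex a ea Q →
        c₀ :+ x :* ex :+ a :* (ea :+ x :* Q) := c₀ :+ a :* ea :+ x :* (ex :+ a :* Q)) refl c₀ x ex a ea Q ⟩
      c₀ + a * ea + x * (ex + a * Q)   ≈⟨ +-congˡ (*-congˡ (eval-quotientBy a (c ∘ Fin.suc) x)) ⟩
      c₀ + a * ea + x * (ea + x * Q)   ∎
      where
      c₀ = c Fin.zero
      ex = eval (c ∘ Fin.suc) x
      ea = eval (c ∘ Fin.suc) a
      Q = eval (quotientBy a (c ∘ Fin.suc)) x

    -- Descent from the top coefficient: once all later coefficients of `c` vanish, a coefficient of
    -- the quotient reduces to a single one of `c`.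
    quotientBy-≈0 : ∀ {m} a (c : Coefficients (suc m)) →
      (∀ i → quotientBy a c i ≈ 0#) → ∀ i → c (Fin.suc i) ≈ 0#
    quotientBy-≈0 {suc m} a c q≈0 (Fin.suc i) = quotientBy-≈0 a (c ∘ Fin.suc) (q≈0 ∘ Fin.suc) i
    quotientBy-≈0 {suc m} a c q≈0 Fin.zero = begin
      c (Fin.suc Fin.zero)           ≈⟨ +-identityʳ _ ⟨
      c (Fin.suc Fin.zero) + 0#      ≈⟨ +-congˡ (trans (*-congˡ (eval-≈0 _ tail≈0 a)) (zeroʳ a)) ⟨
      eval (c ∘ Fin.suc) a           ≈⟨ q≈0 Fin.zero ⟩
      0#                             ∎
      where
      tail≈0 : ∀ i → c (Fin.suc (Fin.suc i)) ≈ 0#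
      tail≈0 = quotientBy-≈0 a (c ∘ Fin.suc) (q≈0 ∘ Fin.suc)

    module _ (integral : ∀ a b → a * b ≈ 0# → a ≈ 0# ⊎ b ≈ 0#) where

      -- Divide out the first root. By integrality the quotient vanishes at the other roots, so it
      -- is zero by induction, and only the constant term of `c` is left.
      roots⇒≈0 : ∀ {m} (c : Coefficients m) (r : Fin m → Carrier) →
        (∀ {i j} → r i ≈ r j → i ≡ j) → (∀ i → eval c (r i) ≈ 0#) → ∀ i → c i ≈ 0#
      roots⇒≈0 {suc m} c r r-inj root = λ { Fin.zero → head≈0 ; (Fin.suc i) → tail≈0 i }
        where
        a = r Fin.zero
        q = quotientBy a c
        q-root : ∀ i → eval q (r (Fin.suc i)) ≈ 0#
        q-root i with integral (r (Fin.suc i) - a) (eval q (r (Fin.suc i))) difference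
          where
          difference : (r (Fin.suc i) - a) * eval q (r (Fin.suc i)) ≈ 0#
          difference = trans ([y-z]x≈yx-zx _ _ _) (x≈y⇒x∙y⁻¹≈ε (sym (∙-cancelˡ 0# _ _
            (trans (+-congʳ (sym (root (Fin.suc i))))
              (trans (eval-quotientBy a c (r (Fin.suc i))) (+-congʳ (root Fin.zero)))))))
        ... | inj₁ x-a≈0 = contradiction (r-inj (x∙y⁻¹≈ε⇒x≈y _ _ x-a≈0)) λ ()
        ... | inj₂ q≈0 = q≈0
        tail≈0 : ∀ i → c (Fin.suc i) ≈ 0#
        tail≈0 = quotientBy-≈0 a c (roots⇒≈0 q (r ∘ Fin.suc) (Fin.suc-injective ∘ r-inj) q-root)
        head≈0 : c Fin.zero ≈ 0#
        head≈0 = begin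
          c Fin.zero        ≈⟨ +-identityʳ _ ⟨
          c Fin.zero + 0#   ≈⟨ +-congˡ (trans (*-congˡ (eval-≈0 _ tail≈0 a)) (zeroʳ a)) ⟨
          eval c a          ≈⟨ root Fin.zero ⟩
          0#                ∎

      agree⇒≈ : ∀ {m} (c d : Coefficients m) (r : Fin m → Carrier) →
        (∀ {i j} → r i ≈ r j → i ≡ j) → (∀ i → eval c (r i) ≈ eval d (r i)) → ∀ i → c i ≈ d i
      agree⇒≈ c d r r-inj agree i = x∙y⁻¹≈ε⇒x≈y _ _ (roots⇒≈0 (λ j → c j - d j) r r-inj
        (λ j → trans (eval-- c d (r j)) (x≈y⇒x∙y⁻¹≈ε (agree j))) i)

  module FiniteField (K : CommutativeRing 0ℓ 0ℓ) where
    open CommutativeRing K renaming (zero to *-zero)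
    open import Algebra.Properties.Semiring.Exp semiring
    open import Algebra.Properties.Semiring.Mult semiring renaming (_×_ to _×ᴿ_)
    open import Algebra.Properties.Group +-group using (∙-cancelˡ; ∙-cancelʳ; x∙y⁻¹≈ε⇒x≈y; x≈y⇒x∙y⁻¹≈ε)
    open import Algebra.Properties.Ring ring using (x[y-z]≈xy-xz)
    open import Relation.Binary.Reasoning.Setoid setoid
    open Polynomials K

    module Lines
      (integral : ∀ a b → a * b ≈ 0# → a ≈ 0# ⊎ b ≈ 0#)
      {n : ℕ} (element : Fin n → Carrier)
      (element-injective : ∀ {z w} → element z ≈ element w → z ≡ w)
      (element-surjective : ∀ b → ∃ λ z → element z ≈ b)
      where

      index : Carrier → Fin (n)
      index b = proj₁ (element-surjective b)

      index-injective : ∀ {a b} → index a ≡ index b → a ≈ b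
      index-injective {a} {b} eq = begin
        a                   ≈⟨ proj₂ (element-surjective a) ⟨
        element (index a)   ≡⟨ ≡.cong element eq ⟩
        element (index b)   ≈⟨ proj₂ (element-surjective b) ⟩
        b                   ∎

      -- The line with intercept `u` and slope `v`, recorded by its ordinate over each field
      -- element; coordinate zero is its point at infinity, the slope.
      line : Fin (n) × Fin (n) → Fin (suc (n)) → Fin (n)
      line (u , v) Fin.zero = v
      line (u , v) (Fin.suc s) = index (element u + element v * element s)

      line-offset : ∀ {u v u′ s} → line (u , v) (Fin.suc s) ≡ line (u′ , v) (Fin.suc s) → u ≡ u′
      line-offset eq = element-injective (∙-cancelʳ _ _ _ (index-injective eq))

      -- Each agreement says `(b − b′) x = a′ − a`, once at `x = e` and once at `x = d`. Subtracting
      -- gives `(b − b′)(e − d) = 0`.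
      line-slope : ∀ {u v u′ v′ s t} → s ≢ t →
        line (u , v) (Fin.suc s) ≡ line (u′ , v′) (Fin.suc s) →
        line (u , v) (Fin.suc t) ≡ line (u′ , v′) (Fin.suc t) → v ≡ v′
      line-slope {u} {v} {u′} {v′} {s} {t} s≢t eqₛ eqₜ
        with integral (element v - element v′) (element s - element t) (begin
          (b - b′) * (e - d)                   ≈⟨ x[y-z]≈xy-xz (b - b′) e d ⟩
          (b - b′) * e - (b - b′) * d
            ≈⟨ x≈y⇒x∙y⁻¹≈ε (trans (difference (index-injective eqₛ)) (sym (difference (index-injective eqₜ)))) ⟩
          0#                                   ∎)
        where
        a = element u
        a′ = element u′
        b = element v
        b′ = element v′
        e = element s
        d = element t
        difference : ∀ {x} → a + b * x ≈ a′ + b′ * x → (b - b′) * x ≈ a′ - a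
        difference {x} eq = ∙-cancelˡ (a + b′ * x) _ _ (begin
          a + b′ * x + (b - b′) * x
            ≈⟨ solve 5 (λ a b c m x → a :+ c :* x :+ (b :+ m) :* x := a :+ b :* x :+ (c :+ m) :* x) refl a b b′ (- b′) x ⟩
          a + b * x + (b′ - b′) * x            ≈⟨ +-cong eq (trans (*-congʳ (-‿inverseʳ b′)) (zeroˡ x)) ⟩
          a′ + b′ * x + 0#                     ≈⟨ +-congˡ (-‿inverseʳ a) ⟨
          a′ + b′ * x + (a - a)
            ≈⟨ solve 4 (λ a c m y → c :+ y :+ (a :+ m) := a :+ y :+ (c :+ m)) refl a a′ (- a) (b′ * x) ⟩
          a + b′ * x + (a′ - a)                ∎)
      ... | inj₁ v-v′≈0 = element-injective (x∙y⁻¹≈ε⇒x≈y _ _ v-v′≈0)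
      ... | inj₂ s-t≈0 = contradiction (element-injective (x∙y⁻¹≈ε⇒x≈y _ _ s-t≈0)) s≢t

      line-unique : ∀ {x y i j} → i ≢ j → line x i ≡ line y i → line x j ≡ line y j → x ≡ y
      line-unique {i = Fin.zero} {Fin.zero} i≢j _ _ = contradiction ≡.refl i≢j
      line-unique {i = Fin.zero} {Fin.suc t} _ ≡.refl eqₜ = ≡.cong (_, _) (line-offset eqₜ)
      line-unique {i = Fin.suc s} {Fin.zero} _ eqₛ ≡.refl = ≡.cong (_, _) (line-offset eqₛ)
      line-unique {u , v} {u′ , v′} {Fin.suc s} {Fin.suc t} i≢j eqₛ eqₜ
        with line-slope {u} {v} {u′} {v′} (i≢j ∘ ≡.cong Fin.suc) eqₛ eqₜ
      ... | ≡.refl = ≡.cong (_, v) (line-offset eqₛ)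

    module Elements
      (p : ℕ) (pp : Prime p) (k N : ℕ) (p^k≡2+N : p ℕ.^ k ≡ suc (suc N))
      (p×1≈0 : p ×ᴿ 1# ≈ 0#) (1≉0 : ¬ 1# ≈ 0#)
      (_≈?_ : ∀ a b → Dec (a ≈ b))
      (root-of-unity : ∀ a → a ≈ 0# ⊎ a ^ suc N ≈ 1#)
      (y : Carrier) (y-large : ∀ d → 0 < d → d < k → ¬ y ^ (p ℕ.^ d) ≈ y)
      where
      open Frobenius K p pp using (frobenius-+; frobenius-×; ^-distrib-*; 0^p^k≈0)

      -- A nonzero `a` is a unit with inverse `a ^ N`.
      integral : ∀ a b → a * b ≈ 0# → a ≈ 0# ⊎ b ≈ 0#
      integral a b ab≈0 with root-of-unity a
      ... | inj₁ a≈0 = inj₁ a≈0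
      ... | inj₂ a^N≈1 = inj₂ (begin
        b                  ≈⟨ *-identityˡ b ⟨
        1# * b             ≈⟨ *-congʳ a^N≈1 ⟨
        a * a ^ N * b      ≈⟨ solve 3 (λ a c b → a :* c :* b := c :* (a :* b)) refl a (a ^ N) b ⟩
        a ^ N * (a * b)    ≈⟨ *-congˡ ab≈0 ⟩
        a ^ N * 0#         ≈⟨ zeroʳ _ ⟩
        0#                 ∎)

      a^p^k≈a : ∀ a → a ^ (p ℕ.^ k) ≈ a
      a^p^k≈a a with root-of-unity a
      ... | inj₁ a≈0 = trans (^-congˡ (p ℕ.^ k) a≈0) (trans (0^p^k≈0 p×1≈0 k) (sym a≈0))
      ... | inj₂ a^N≈1 = trans (^-congʳ a p^k≡2+N) (trans (*-congˡ a^N≈1) (*-identityʳ a))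

      conjugate : Fin k → Carrier
      conjugate i = y ^ (p ℕ.^ toℕ i)

      -- Raising to the power `p ^ (k ∸ i)` completes the first conjugate to `y ^ (p ^ k) ≈ y` and
      -- turns the second into `y ^ (p ^ (j ∸ i))`, against `y-large`.
      conjugate-< : ∀ {i j : Fin k} → i Fin.< j → ¬ conjugate i ≈ conjugate j
      conjugate-< {i} {j} i<j eq = y-large (toℕ j ∸ toℕ i) (ℕ.m<n⇒0<n∸m i<j)
        (ℕ.≤-<-trans (ℕ.m∸n≤m (toℕ j) (toℕ i)) (Fin.toℕ<n j)) (begin
          y ^ (p ℕ.^ (toℕ j ∸ toℕ i))            ≈⟨ a^p^k≈a _ ⟨
          (y ^ (p ℕ.^ (toℕ j ∸ toℕ i))) ^ (p ℕ.^ k) ≈⟨ ^-assocʳ y (p ℕ.^ (toℕ j ∸ toℕ i)) (p ℕ.^ k) ⟩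
          y ^ (p ℕ.^ (toℕ j ∸ toℕ i) ℕ.* p ℕ.^ k)   ≈⟨ ^-congʳ y exponents ⟩
          y ^ (p ℕ.^ toℕ j ℕ.* p ℕ.^ (k ∸ toℕ i))   ≈⟨ ^-assocʳ y (p ℕ.^ toℕ j) (p ℕ.^ (k ∸ toℕ i)) ⟨
          conjugate j ^ (p ℕ.^ (k ∸ toℕ i))         ≈⟨ ^-congˡ (p ℕ.^ (k ∸ toℕ i)) eq ⟨
          conjugate i ^ (p ℕ.^ (k ∸ toℕ i))         ≈⟨ ^-assocʳ y (p ℕ.^ toℕ i) (p ℕ.^ (k ∸ toℕ i)) ⟩
          y ^ (p ℕ.^ toℕ i ℕ.* p ℕ.^ (k ∸ toℕ i))
            ≈⟨ ^-congʳ y (≡.trans (≡.sym (ℕ.^-distribˡ-+-* p (toℕ i) _)) (≡.cong (p ℕ.^_) (ℕ.m+[n∸m]≡n i≤k))) ⟩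
          y ^ (p ℕ.^ k)                             ≈⟨ a^p^k≈a y ⟩
          y                                         ∎)
        where
        i≤k : toℕ i ≤ k
        i≤k = ℕ.<⇒≤ (Fin.toℕ<n i)
        exponents : p ℕ.^ (toℕ j ∸ toℕ i) ℕ.* p ℕ.^ k ≡ p ℕ.^ toℕ j ℕ.* p ℕ.^ (k ∸ toℕ i)
        exponents = ≡.trans (≡.sym (ℕ.^-distribˡ-+-* p (toℕ j ∸ toℕ i) k)) (≡.trans (≡.cong (p ℕ.^_)
          (≡.trans (≡.sym (ℕ.+-∸-comm k (ℕ.<⇒≤ i<j))) (ℕ.+-∸-assoc (toℕ j) i≤k)))
          (ℕ.^-distribˡ-+-* p (toℕ j) _))

      conjugate-injective : ∀ {i j} → conjugate i ≈ conjugate j → i ≡ j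
      conjugate-injective {i} {j} eq with Fin.<-cmp i j
      ... | tri< i<j _ _ = contradiction eq (conjugate-< i<j)
      ... | tri≈ _ i≡j _ = i≡j
      ... | tri> _ _ j<i = contradiction (sym eq) (conjugate-< j<i)

      digits : Fin (p ℕ.^ k) → Coefficients k
      digits z i = toℕ (finToFun z i) ×ᴿ 1#

      -- The prime-field combinations of 1, y, ..., y^(k-1), numbered by their coefficients read as
      -- base-`p` digits.
      element : Fin (p ℕ.^ k) → Carrier
      element z = eval (digits z) y

      -- Evaluation is made of sums and products, which the Frobenius map respects. Hence a relation
      -- satisfied by `y` passes to its conjugates.
      eval-frobenius : ∀ {m} (c : Coefficients m) → ∀ d → (∀ i → c i ^ (p ℕ.^ d) ≈ c i) →
        ∀ x → eval c (x ^ (p ℕ.^ d)) ≈ eval c x ^ (p ℕ.^ d)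
      eval-frobenius {zero} c d fixed x = sym (0^p^k≈0 p×1≈0 d)
      eval-frobenius {suc m} c d fixed x = begin
        c₀ + x ^ (p ℕ.^ d) * eval (c ∘ Fin.suc) (x ^ (p ℕ.^ d))
          ≈⟨ +-cong (sym (fixed Fin.zero)) (*-congˡ (eval-frobenius (c ∘ Fin.suc) d (fixed ∘ Fin.suc) x)) ⟩
        c₀ ^ (p ℕ.^ d) + x ^ (p ℕ.^ d) * eval (c ∘ Fin.suc) x ^ (p ℕ.^ d)
          ≈⟨ +-congˡ (^-distrib-* x _ (p ℕ.^ d)) ⟨
        c₀ ^ (p ℕ.^ d) + (x * eval (c ∘ Fin.suc) x) ^ (p ℕ.^ d)
          ≈⟨ frobenius-+ p×1≈0 d _ _ ⟨
        (c₀ + x * eval (c ∘ Fin.suc) x) ^ (p ℕ.^ d) ∎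
        where c₀ = c Fin.zero

      bézout⇒1≈0 : ∀ u v a b → 1 ℕ.+ v ℕ.* b ≡ u ℕ.* a → a ×ᴿ 1# ≈ 0# → b ×ᴿ 1# ≈ 0# → 1# ≈ 0#
      bézout⇒1≈0 u v a b eq a≈0 b≈0 = begin
        1#                               ≈⟨ +-identityʳ 1# ⟨
        1# + 0#                          ≈⟨ +-congˡ (trans (*-congˡ b≈0) (zeroʳ _)) ⟨
        1# + (v ×ᴿ 1#) * (b ×ᴿ 1#)         ≈⟨ +-congˡ (×1-homo-* v b) ⟨
        (1 ℕ.+ v ℕ.* b) ×ᴿ 1#             ≡⟨ ≡.cong (_×ᴿ 1#) eq ⟩
        (u ℕ.* a) ×ᴿ 1#                   ≈⟨ ×1-homo-* u a ⟩
        (u ×ᴿ 1#) * (a ×ᴿ 1#)              ≈⟨ trans (*-congˡ a≈0) (zeroʳ _) ⟩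
        0#                               ∎

      -- A positive `m` below `p` is prime to `p`, so a Bézout identity would express `1#` through
      -- two vanishing multiples.
      m×1≈0⇒m≡0 : ∀ m → m < p → m ×ᴿ 1# ≈ 0# → m ≡ 0
      m×1≈0⇒m≡0 zero _ _ = ≡.refl
      m×1≈0⇒m≡0 m@(suc _) m<p m×1≈0 with coprime-Bézout (prime⇒coprime pp m<p)
      ... | Bézout.+- u v eq = contradiction (bézout⇒1≈0 u v p m eq p×1≈0 m×1≈0) 1≉0
      ... | Bézout.-+ u v eq = contradiction (bézout⇒1≈0 v u m p eq m×1≈0 p×1≈0) 1≉0

      ×1-injective-≤ : ∀ {a b} → a ≤ b → b < p → a ×ᴿ 1# ≈ b ×ᴿ 1# → a ≡ b
      ×1-injective-≤ {a} {b} a≤b b<p eq = ≡.trans (≡.sym (ℕ.+-identityʳ a)) (≡.trans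
        (≡.cong (a ℕ.+_) (≡.sym (m×1≈0⇒m≡0 (b ∸ a) (ℕ.≤-<-trans (ℕ.m∸n≤m b a) b<p) b-a≈0)))
        (ℕ.m+[n∸m]≡n a≤b))
        where
        b-a≈0 : (b ∸ a) ×ᴿ 1# ≈ 0#
        b-a≈0 = ∙-cancelˡ (a ×ᴿ 1#) _ _ (begin
          a ×ᴿ 1# + (b ∸ a) ×ᴿ 1#   ≈⟨ ×-homo-+ 1# a (b ∸ a) ⟨
          (a ℕ.+ (b ∸ a)) ×ᴿ 1#    ≡⟨ ≡.cong (_×ᴿ 1#) (ℕ.m+[n∸m]≡n a≤b) ⟩
          b ×ᴿ 1#                  ≈⟨ eq ⟨
          a ×ᴿ 1#                  ≈⟨ +-identityʳ _ ⟨
          a ×ᴿ 1# + 0#             ∎)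

      ×1-injective : ∀ {a b} → a < p → b < p → a ×ᴿ 1# ≈ b ×ᴿ 1# → a ≡ b
      ×1-injective {a} {b} a<p b<p eq with ℕ.≤-total a b
      ... | inj₁ a≤b = ×1-injective-≤ a≤b b<p eq
      ... | inj₂ b≤a = ≡.sym (×1-injective-≤ b≤a a<p (sym eq))

      -- A relation between 1, y, …, y^(k-1) with coefficients in the prime field would be
      -- satisfied by the k conjugates of y.
      element-injective : ∀ {z w} → element z ≈ element w → z ≡ w
      element-injective {z} {w} eq = ≡.trans (≡.sym (Fin.funToFin-finToFin {k} {p} z))
        (≡.trans (funToFin-cong digit≡) (Fin.funToFin-finToFin {k} {p} w))
        where
        funToFin-cong : ∀ {m n} {f g : Fin m → Fin n} → (∀ i → f i ≡ g i) → funToFin f ≡ funToFin g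
        funToFin-cong {zero} f≗g = ≡.refl
        funToFin-cong {suc m} f≗g = ≡.cong₂ Fin.combine (f≗g Fin.zero) (funToFin-cong (f≗g ∘ Fin.suc))
        digits≈ : ∀ i → digits z i ≈ digits w i
        digits≈ = agree⇒≈ integral (digits z) (digits w) conjugate conjugate-injective λ i → begin
          eval (digits z) (conjugate i)
            ≈⟨ eval-frobenius (digits z) (toℕ i) (λ j → frobenius-× p×1≈0 (toℕ i) (toℕ (finToFun z j))) y ⟩
          element z ^ (p ℕ.^ toℕ i)       ≈⟨ ^-congˡ (p ℕ.^ toℕ i) eq ⟩
          element w ^ (p ℕ.^ toℕ i)
            ≈⟨ eval-frobenius (digits w) (toℕ i) (λ j → frobenius-× p×1≈0 (toℕ i) (toℕ (finToFun w j))) y ⟨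
          eval (digits w) (conjugate i)   ∎
        digit≡ : ∀ i → finToFun z i ≡ finToFun w i
        digit≡ i = Fin.toℕ-injective (×1-injective (Fin.toℕ<n _) (Fin.toℕ<n _) (digits≈ i))

      -- An element outside the list would be one root too many of X^(p^k) − X.
      element-surjective : ∀ b → ∃ λ z → element z ≈ b
      element-surjective b with Fin.any? (λ z → element z ≈? b)
      ... | yes found = found
      ... | no missing = contradiction (sym (0≈1 p^k≡2+N)) 1≉0
        where
        roots : ∀ {n} → (Fin n → Carrier) → Fin (suc n) → Carrier
        roots e Fin.zero = b
        roots e (Fin.suc z) = e z
        roots-injective : ∀ {i j} → roots element i ≈ roots element j → i ≡ j
        roots-injective {Fin.zero} {Fin.zero} _ = ≡.refl
        roots-injective {Fin.zero} {Fin.suc j} eq = contradiction (j , sym eq) missing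
        roots-injective {Fin.suc i} {Fin.zero} eq = contradiction (i , eq) missing
        roots-injective {Fin.suc i} {Fin.suc j} eq = ≡.cong Fin.suc (element-injective eq)
        0≈1 : ∀ {n} → p ℕ.^ k ≡ suc (suc n) → 0# ≈ 1#
        -- X^(p^k) and X are both given `p ^ k + 1` coefficients and agree at as many points. At
        -- `t`, the coefficient of X, they have `0#` and `1#`.
        0≈1 {n} eq = agree⇒≈ integral (monomial s) (monomial t)
          (λ i → roots element (≡.subst (Fin ∘ suc) (≡.sym eq) i))
          (λ e → subst-injective (≡.sym eq) (roots-injective e))
          (λ i → trans (eval-monomial s _) (trans
            (trans (^-congʳ _ (≡.trans (Fin.toℕ-fromℕ (suc (suc n))) (≡.sym eq))) (a^p^k≈a _))
            (sym (trans (eval-monomial t _) (*-identityʳ _))))) t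
          where
          s t : Fin (suc (suc (suc n)))
          s = fromℕ (suc (suc n))
          t = Fin.suc Fin.zero
          subst-injective : ∀ {a b} (eq : a ≡ b) {i j : Fin (suc a)} →
            ≡.subst (Fin ∘ suc) eq i ≡ ≡.subst (Fin ∘ suc) eq j → i ≡ j
          subst-injective ≡.refl e = e

      open Lines integral element element-injective element-surjective public using (line; line-unique)

-- The algebra 𝔽_p[X] / (X^N - 1) acting on periodic sequences.

module ShiftAlgebras where
  open import Data.List using (map; upTo; cartesianProductWith)
  open import Data.List.Membership.Propositional using (_∈_)
  open import Data.List.Membership.Propositional.Properties using (∈-cartesianProductWith⁺; ∈-upTo⁺)
  open import Data.List.Relation.Unary.All as All using (All; []; _∷_)
  open import Data.List.Relation.Unary.Any using (here)
  open import Data.Vec as Vec using (Vec; []; _∷_; toList; initLast; _∷ʳ_)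
  open import Data.Nat using (_+_; _*_; _%_)
  open import Relation.Binary.PropositionalEquality using (refl; sym; trans; cong; cong₂; subst; module ≡-Reasoning)

  module ShiftAlgebra (p : ℕ) .{{_ : NonZero p}} (N′ : ℕ) where

    N : ℕ
    N = suc N′

    infix 4 _≋_ _≈_
    infixl 6 _⊞_
    infixl 7 _⊠_

    -- A record instead of a bare equation of remainders, so that `a` and `b` can be inferred from
    -- the type.
    record _≋_ (a b : ℕ) : Set where
      constructor mod≡
      field mod : a % p ≡ b % p
    open _≋_

    ≋-refl : ∀ {a} → a ≋ a
    ≋-refl = mod≡ refl

    ≋-sym : ∀ {a b} → a ≋ b → b ≋ a
    ≋-sym (mod≡ e) = mod≡ (sym e)

    ≋-trans : ∀ {a b c} → a ≋ b → b ≋ c → a ≋ c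
    ≋-trans (mod≡ e) (mod≡ e′) = mod≡ (trans e e′)

    ≋-reflexive : ∀ {a b} → a ≡ b → a ≋ b
    ≋-reflexive e = mod≡ (cong (_% p) e)

    ≋-+ : ∀ {a b c d} → a ≋ b → c ≋ d → a + c ≋ b + d
    ≋-+ {a} {b} {c} {d} (mod≡ e) (mod≡ e′) = mod≡ (trans (ℕ.%-distribˡ-+ a c p)
      (trans (cong₂ (λ x y → (x + y) % p) e e′) (sym (ℕ.%-distribˡ-+ b d p))))

    ≋-*ˡ : ∀ c {a b} → a ≋ b → c * a ≋ c * b
    ≋-*ˡ c {a} {b} (mod≡ e) = mod≡ (trans (ℕ.%-distribˡ-* c a p)
      (trans (cong (λ x → (c % p * x) % p) e) (sym (ℕ.%-distribˡ-* c b p))))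

    p*a≋0 : ∀ a → p * a ≋ 0
    p*a≋0 a = mod≡ (trans (trans (cong (_% p) (ℕ.*-comm p a)) (ℕ.m*n%n≡0 a p))
      (sym (ℕ.m*n%n≡0 0 p)))

    Seq : Set
    Seq = ℕ → ℕ

    Periodic : Seq → Set
    Periodic u = ∀ i → u (i + N) ≡ u i

    -- The polynomial in the shift with the given coefficients, constant term first.
    act : List ℕ → Seq → Seq
    act [] u i = 0
    act (c ∷ f) u i = c * u i + act f u (suc i)

    act-cong : ∀ f {u v} → (∀ i → u i ≋ v i) → ∀ i → act f u i ≋ act f v i
    act-cong [] u≋v i = ≋-refl
    act-cong (c ∷ f) u≋v i = ≋-+ (≋-*ˡ c (u≋v i)) (act-cong f u≋v (suc i))

    act-zero : ∀ f i → act f (λ _ → 0) i ≡ 0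
    act-zero [] i = refl
    act-zero (c ∷ f) i = cong₂ _+_ (ℕ.*-zeroʳ c) (act-zero f (suc i))

    act-add : ∀ f u v i → act f (λ j → u j + v j) i ≡ act f u i + act f v i
    act-add [] u v i = refl
    act-add (c ∷ f) u v i = trans (cong (c * (u i + v i) +_) (act-add f u v (suc i)))
      (solve 5 (λ c a b d e → c :* (a :+ b) :+ (d :+ e) := c :* a :+ d :+ (c :* b :+ e)) refl
        c (u i) (v i) _ _)
      where open +-*-Solver

    act-mul : ∀ f c u i → act f (λ j → c * u j) i ≡ c * act f u i
    act-mul [] c u i = sym (ℕ.*-zeroʳ c)
    act-mul (d ∷ f) c u i = trans (cong (d * (c * u i) +_) (act-mul f c u (suc i)))
      (solve 4 (λ d c a b → d :* (c :* a) :+ c :* b := c :* (d :* a :+ b)) refl d c (u i) _)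
      where open +-*-Solver

    act-suc : ∀ f u i → act f (u ∘ suc) i ≡ act f u (suc i)
    act-suc [] u i = refl
    act-suc (c ∷ f) u i = cong (c * u (suc i) +_) (act-suc f u (suc i))

    act-periodic : ∀ f {u} → Periodic u → Periodic (act f u)
    act-periodic [] per i = refl
    act-periodic (c ∷ f) per i = cong₂ (λ a b → c * a + b) (per i) (act-periodic f per (suc i))

    -- Both sides are polynomials in the same operator: `act g` is additive and commutes with
    -- scalars and with the shift.
    act-comm : ∀ f g u i → act f (act g u) i ≡ act g (act f u) i
    act-comm [] g u i = sym (act-zero g i)
    act-comm (c ∷ f) g u i = begin
      c * act g u i + act f (act g u) (suc i)
        ≡⟨ cong₂ _+_ (sym (act-mul g c u i)) (act-comm f g u (suc i)) ⟩
      act g (λ j → c * u j) i + act g (act f u) (suc i)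
        ≡⟨ cong (act g (λ j → c * u j) i +_) (act-suc g (act f u) i) ⟨
      act g (λ j → c * u j) i + act g (act f u ∘ suc) i
        ≡⟨ act-add g (λ j → c * u j) (act f u ∘ suc) i ⟨
      act g (act (c ∷ f) u) i ∎
      where open ≡.≡-Reasoning

    _⊞_ : List ℕ → List ℕ → List ℕ
    [] ⊞ g = g
    (a ∷ f) ⊞ [] = a ∷ f
    (a ∷ f) ⊞ (b ∷ g) = (a + b) ∷ (f ⊞ g)

    scale : ℕ → List ℕ → List ℕ
    scale c = map (c *_)

    _⊠_ : List ℕ → List ℕ → List ℕ
    [] ⊠ g = []
    (a ∷ f) ⊠ g = scale a g ⊞ (0 ∷ (f ⊠ g))

    -- Coefficients are natural numbers, so -1 is represented by `p − 1`.
    negate : List ℕ → List ℕ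
    negate = scale (pred p)

    one : List ℕ
    one = 1 ∷ []

    act-⊞ : ∀ f g u i → act (f ⊞ g) u i ≡ act f u i + act g u i
    act-⊞ [] g u i = refl
    act-⊞ (a ∷ f) [] u i = sym (ℕ.+-identityʳ _)
    act-⊞ (a ∷ f) (b ∷ g) u i = trans (cong ((a + b) * u i +_) (act-⊞ f g u (suc i)))
      (solve 5 (λ a b x d e → (a :+ b) :* x :+ (d :+ e) := a :* x :+ d :+ (b :* x :+ e)) refl
        a b (u i) _ _)
      where open +-*-Solver

    act-scale : ∀ c f u i → act (scale c f) u i ≡ c * act f u i
    act-scale c [] u i = sym (ℕ.*-zeroʳ c)
    act-scale c (a ∷ f) u i = trans (cong (c * a * u i +_) (act-scale c f u (suc i)))
      (solve 4 (λ c a x d → c :* a :* x :+ c :* d := c :* (a :* x :+ d)) refl c a (u i) _)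
      where open +-*-Solver

    act-⊠ : ∀ f g u i → act (f ⊠ g) u i ≡ act f (act g u) i
    act-⊠ [] g u i = refl
    act-⊠ (a ∷ f) g u i = trans (act-⊞ (scale a g) (0 ∷ (f ⊠ g)) u i)
      (cong₂ _+_ (act-scale a g u i) (act-⊠ f g u (suc i)))

    act-one : ∀ u i → act one u i ≡ u i
    act-one u i = trans (ℕ.+-identityʳ _) (ℕ.*-identityˡ (u i))

    -- Equality modulo `p` and X^N - 1, expressed by the action on `N`-periodic sequences. The ring
    -- laws thereby become laws of operators, checked pointwise.
    record _≈_ (f g : List ℕ) : Set where
      constructor acts
      field on : ∀ {u} → Periodic u → ∀ i → act f u i ≋ act g u i
    open _≈_ public

    acts≡ : ∀ {f g} → (∀ u i → act f u i ≡ act g u i) → f ≈ g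
    acts≡ f≗g = acts λ {u} _ i → ≋-reflexive (f≗g u i)

    ⊞-cong : ∀ {f f′ g g′} → f ≈ f′ → g ≈ g′ → f ⊞ g ≈ f′ ⊞ g′
    ⊞-cong {f} {f′} {g} {g′} f≈f′ g≈g′ = acts λ {u} per i →
      ≋-trans (≋-reflexive (act-⊞ f g u i)) (≋-trans (≋-+ (on f≈f′ per i) (on g≈g′ per i))
        (≋-reflexive (sym (act-⊞ f′ g′ u i))))

    ⊠-cong : ∀ {f f′ g g′} → f ≈ f′ → g ≈ g′ → f ⊠ g ≈ f′ ⊠ g′
    ⊠-cong {f} {f′} {g} {g′} f≈f′ g≈g′ = acts λ {u} per i →
      ≋-trans (≋-reflexive (act-⊠ f g u i)) (≋-trans (act-cong f (on g≈g′ per) i)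
        (≋-trans (on f≈f′ (act-periodic g′ per) i) (≋-reflexive (sym (act-⊠ f′ g′ u i)))))

    scale-cong : ∀ c {f g} → f ≈ g → scale c f ≈ scale c g
    scale-cong c {f} {g} f≈g = acts λ {u} per i →
      ≋-trans (≋-reflexive (act-scale c f u i)) (≋-trans (≋-*ˡ c (on f≈g per i))
        (≋-reflexive (sym (act-scale c g u i))))

    ⊞-assoc : ∀ f g h → (f ⊞ g) ⊞ h ≈ f ⊞ (g ⊞ h)
    ⊞-assoc f g h = acts≡ λ u i → begin
      act (f ⊞ g ⊞ h) u i                     ≡⟨ act-⊞ (f ⊞ g) h u i ⟩
      act (f ⊞ g) u i + act h u i             ≡⟨ cong (_+ act h u i) (act-⊞ f g u i) ⟩
      act f u i + act g u i + act h u i       ≡⟨ ℕ.+-assoc (act f u i) _ _ ⟩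
      act f u i + (act g u i + act h u i)     ≡⟨ cong (act f u i +_) (act-⊞ g h u i) ⟨
      act f u i + act (g ⊞ h) u i             ≡⟨ act-⊞ f (g ⊞ h) u i ⟨
      act (f ⊞ (g ⊞ h)) u i                   ∎
      where open ≡.≡-Reasoning

    ⊞-comm : ∀ f g → f ⊞ g ≈ g ⊞ f
    ⊞-comm f g = acts≡ λ u i →
      trans (act-⊞ f g u i) (trans (ℕ.+-comm (act f u i) _) (sym (act-⊞ g f u i)))

    ⊞-identityʳ : ∀ f → f ⊞ [] ≈ f
    ⊞-identityʳ f = acts≡ λ u i → trans (act-⊞ f [] u i) (ℕ.+-identityʳ _)

    ⊞-inverseˡ : ∀ f → negate f ⊞ f ≈ []
    ⊞-inverseˡ f = acts λ {u} _ i → ≋-trans (≋-reflexive (trans (act-⊞ (negate f) f u i)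
      (trans (cong (_+ act f u i) (act-scale (pred p) f u i)) (trans (ℕ.+-comm _ (act f u i))
        (cong (_* act f u i) (ℕ.suc-pred p)))))) (p*a≋0 (act f u i))

    ⊠-comm : ∀ f g → f ⊠ g ≈ g ⊠ f
    ⊠-comm f g = acts≡ λ u i →
      trans (act-⊠ f g u i) (trans (act-comm f g u i) (sym (act-⊠ g f u i)))

    ⊠-assoc : ∀ f g h → (f ⊠ g) ⊠ h ≈ f ⊠ (g ⊠ h)
    ⊠-assoc f g h = acts λ {u} _ i → ≋-trans (≋-reflexive (trans (act-⊠ (f ⊠ g) h u i)
      (act-⊠ f g (act h u) i))) (≋-trans (act-cong f (λ j → ≋-reflexive (sym (act-⊠ g h u j))) i)
        (≋-reflexive (sym (act-⊠ f (g ⊠ h) u i))))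

    ⊠-identityˡ : ∀ f → one ⊠ f ≈ f
    ⊠-identityˡ f = acts≡ λ u i → trans (act-⊠ one f u i) (act-one (act f u) i)

    ⊠-distribʳ-⊞ : ∀ f g h → (g ⊞ h) ⊠ f ≈ g ⊠ f ⊞ h ⊠ f
    ⊠-distribʳ-⊞ f g h = acts≡ λ u i → begin
      act ((g ⊞ h) ⊠ f) u i                        ≡⟨ act-⊠ (g ⊞ h) f u i ⟩
      act (g ⊞ h) (act f u) i                      ≡⟨ act-⊞ g h (act f u) i ⟩
      act g (act f u) i + act h (act f u) i        ≡⟨ cong₂ _+_ (act-⊠ g f u i) (act-⊠ h f u i) ⟨
      act (g ⊠ f) u i + act (h ⊠ f) u i            ≡⟨ act-⊞ (g ⊠ f) (h ⊠ f) u i ⟨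
      act (g ⊠ f ⊞ h ⊠ f) u i                      ∎
      where open ≡.≡-Reasoning

    ≈-trans : ∀ {f g h} → f ≈ g → g ≈ h → f ≈ h
    ≈-trans f≈g g≈h = acts λ per i → ≋-trans (on f≈g per i) (on g≈h per i)

    commutativeRing : CommutativeRing 0ℓ 0ℓ
    commutativeRing = record
      { Carrier = List ℕ ; _≈_ = _≈_ ; _+_ = _⊞_ ; _*_ = _⊠_ ; -_ = negate ; 0# = [] ; 1# = one
      ; isCommutativeRing = record
        { isRing = record
          { +-isAbelianGroup = record
            { isGroup = record
              { isMonoid = record
                { isSemigroup = record
                  { isMagma = record
                    { isEquivalence = record
                      { refl = acts λ _ _ → ≋-refl
                      ; sym = λ f≈g → acts λ per i → ≋-sym (on f≈g per i)
                      ; trans = ≈-trans }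
                    ; ∙-cong = ⊞-cong }
                  ; assoc = ⊞-assoc }
                ; identity = (λ _ → acts λ _ _ → ≋-refl) , ⊞-identityʳ }
              ; inverse = ⊞-inverseˡ , λ f → ≈-trans (⊞-comm f (negate f)) (⊞-inverseˡ f)
              ; ⁻¹-cong = scale-cong (pred p) }
            ; comm = ⊞-comm }
          ; *-cong = ⊠-cong
          ; *-assoc = ⊠-assoc
          ; *-identity = ⊠-identityˡ , λ f → ≈-trans (⊠-comm f one) (⊠-identityˡ f)
          ; distrib = (λ f g h → ≈-trans (⊠-comm f (g ⊞ h)) (≈-trans (⊠-distribʳ-⊞ f g h)
                        (⊞-cong (⊠-comm g f) (⊠-comm h f)))) , ⊠-distribʳ-⊞ }
        ; *-comm = ⊠-comm } }

    open CommutativeRing commutativeRing public using (semiring) renaming (sym to ≈-sym; refl to ≈-refl)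
    open import Algebra.Properties.Semiring.Exp semiring public
    open import Algebra.Properties.Semiring.Mult semiring public
      renaming (_×_ to _×ᴿ_)

    X : List ℕ
    X = 0 ∷ 1 ∷ []

    act-X : ∀ u i → act X u i ≡ u (suc i)
    act-X u i = act-one u (suc i)

    act-X^ : ∀ m u i → act (X ^ m) u i ≡ u (i + m)
    act-X^ zero u i = trans (act-one u i) (cong u (sym (ℕ.+-identityʳ i)))
    act-X^ (suc m) u i = begin
      act (X ⊠ X ^ m) u i           ≡⟨ act-⊠ X (X ^ m) u i ⟩
      act X (act (X ^ m) u) i       ≡⟨ act-X (act (X ^ m) u) i ⟩
      act (X ^ m) u (suc i)         ≡⟨ act-X^ m u (suc i) ⟩
      u (suc i + m)                 ≡⟨ cong u (ℕ.+-suc i m) ⟨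
      u (i + suc m)                 ∎
      where open ≡.≡-Reasoning

    X^[1+N]≈X : X ^ suc N ≈ X
    X^[1+N]≈X = acts λ {u} per i → ≋-reflexive (trans (act-X^ (suc N) u i)
      (trans (cong u (ℕ.+-suc i N)) (trans (per (suc i)) (sym (act-X u i)))))

    act-× : ∀ m u i → act (m ×ᴿ one) u i ≡ m * u i
    act-× zero u i = refl
    act-× (suc m) u i = trans (act-⊞ one (m ×ᴿ one) u i) (cong₂ _+_ (act-one u i) (act-× m u i))

    p×1≈0 : p ×ᴿ one ≈ []
    p×1≈0 = acts λ {u} _ i → ≋-trans (≋-reflexive (act-× p u i)) (p*a≋0 (u i))

    horner : ∀ c f → c ∷ f ≈ c ×ᴿ one ⊞ X ⊠ f
    horner c f = acts≡ λ u i → sym (trans (act-⊞ (c ×ᴿ one) (X ⊠ f) u i)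
      (cong₂ _+_ (act-× c u i) (trans (act-⊠ X f u i) (act-X (act f u) i))))

    act-∷ʳ : ∀ {m} (v : Vec ℕ m) z u i → act (toList (v ∷ʳ z)) u i ≡ act (toList v) u i + z * u (i + m)
    act-∷ʳ [] z u i = trans (ℕ.+-identityʳ _) (cong (λ j → z * u j) (sym (ℕ.+-identityʳ i)))
    act-∷ʳ {suc m} (c ∷ v) z u i = trans (cong (c * u i +_) (act-∷ʳ v z u (suc i)))
      (trans (sym (ℕ.+-assoc (c * u i) _ _))
        (cong (λ j → c * u i + act (toList v) u (suc i) + z * u j) (sym (ℕ.+-suc i m))))

    -- Prepending `c` pushes the top coefficient `z` to X^N, which acts as 1 on periodic sequences;
    -- so `z` is added to the constant term.
    reduce : ∀ f → ∃ λ (v : Vec ℕ N) → f ≈ toList v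
    reduce [] = Vec.replicate N 0 , acts≡ λ u i → sym (zeros N u i)
      where
      zeros : ∀ m u i → act (toList (Vec.replicate m 0)) u i ≡ 0
      zeros zero u i = refl
      zeros (suc m) u i = zeros m u (suc i)
    reduce (c ∷ f) with reduce f
    ... | v , f≈v with initLast v
    ... | w , z , refl = (c + z) ∷ w , acts λ {u} per i →
      ≋-trans (≋-+ {c * u i} ≋-refl (on f≈v per (suc i))) (≋-reflexive (begin
        c * u i + act (toList (w ∷ʳ z)) u (suc i)
          ≡⟨ cong (c * u i +_) (act-∷ʳ w z u (suc i)) ⟩
        c * u i + (act (toList w) u (suc i) + z * u (suc i + N′))
          ≡⟨ cong (λ x → c * u i + (act (toList w) u (suc i) + z * x))
               (trans (cong u (sym (ℕ.+-suc i N′))) (per i)) ⟩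
        c * u i + (act (toList w) u (suc i) + z * u i)
          ≡⟨ solve 4 (λ c z x a → c :* x :+ (a :+ z :* x) := (c :+ z) :* x :+ a) refl c z (u i) _ ⟩
        (c + z) * u i + act (toList w) u (suc i) ∎))
      where
      open ≡.≡-Reasoning
      open +-*-Solver

    residues : ℕ → List (List ℕ)
    residues zero = [] ∷ []
    residues (suc m) = cartesianProductWith _∷_ (upTo p) (residues m)

    reduced : ∀ {m} (v : Vec ℕ m) → toList (Vec.map (_% p) v) ∈ residues m
    reduced [] = here refl
    reduced (c ∷ v) = ∈-cartesianProductWith⁺ _∷_ (∈-upTo⁺ (ℕ.m%n<n c p)) (reduced v)

    reduced-≈ : ∀ {m} (v : Vec ℕ m) → toList v ≈ toList (Vec.map (_% p) v)
    reduced-≈ v = acts λ {u} _ → go v u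
      where
      go : ∀ {m} (v : Vec ℕ m) u i → act (toList v) u i ≋ act (toList (Vec.map (_% p) v)) u i
      go [] u i = ≋-refl
      go (c ∷ v) u i = ≋-+ (mod≡ (trans (ℕ.%-distribˡ-* c (u i) p) (sym (trans
        (ℕ.%-distribˡ-* (c % p) (u i) p) (cong (λ x → (x * (u i % p)) % p) (ℕ.m%n%n≡m%n c p)))))) (go v u (suc i))

    elements : List (List ℕ)
    elements = residues N

    -- The ring is finite up to `≈`, which allows the search for a minimal ideal to run through all
    -- of it.
    elements-complete : ∀ f → ∃ λ g → g ∈ elements × f ≈ g
    elements-complete f with reduce f
    ... | v , f≈v = _ , reduced v , ≈-trans f≈v (reduced-≈ v)

    wrap : Seq → Seq
    wrap u i = u (i % N)

    wrap-periodic : ∀ u → Periodic (wrap u)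
    wrap-periodic u i = cong u (ℕ.[m+n]%n≡m%n i N)

    -- Only the values from `i` to `i + m − 1` are read. They lie within the first period, where `u`
    -- and its periodic extension coincide.
    act-wrap : ∀ {m} (v : Vec ℕ m) u i → i + m ≤ N → act (toList v) (wrap u) i ≡ act (toList v) u i
    act-wrap [] u i _ = refl
    act-wrap {suc m} (c ∷ v) u i i+m≤N = cong₂ (λ j a → c * u j + a)
      (ℕ.m<n⇒m%n≡m (ℕ.≤-trans (ℕ.m<m+n i ℕ.z<s) i+m≤N))
      (act-wrap v u (suc i) (subst (_≤ N) (ℕ.+-suc i m) i+m≤N))

    -- The sequence 1, 0, 0, ... reads off the constant term, and prefixing a 0 to a test sequence
    -- moves the test to the tail.
    vanishing⇒All : ∀ f → (∀ u → act f u 0 ≋ 0) → All (_≋ 0) f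
    vanishing⇒All [] _ = []
    vanishing⇒All (c ∷ f) vanish = head ∷ vanishing⇒All f λ u → 
      ≋-trans (≋-reflexive (trans (act-suc f (after u) 0) (cong (_+ act f (after u) 1) (sym (ℕ.*-zeroʳ c)))))
        (vanish (after u))
      where
      unit : Seq
      unit zero = 1
      unit (suc _) = 0
      after : Seq → Seq
      after u zero = 0
      after u (suc i) = u i
      head : c ≋ 0
      head = ≋-trans (≋-reflexive (sym (trans (cong₂ _+_ (ℕ.*-identityʳ c)
        (trans (sym (act-suc f unit 0)) (act-zero f 0))) (ℕ.+-identityʳ c)))) (vanish unit)

    All⇒≈0 : ∀ f → All (_≋ 0) f → f ≈ []
    All⇒≈0 f all = acts λ {u} _ → go f all u
      where
      go : ∀ f → All (_≋ 0) f → ∀ u i → act f u i ≋ 0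
      go [] [] u i = ≋-refl
      go (c ∷ f) (c≋0 ∷ all) u i = ≋-+ (≋-trans (≋-reflexive (ℕ.*-comm c (u i)))
        (≋-trans (≋-*ˡ (u i) c≋0) (≋-reflexive (ℕ.*-zeroʳ (u i))))) (go f all u (suc i))

    -- A representative with `N` coefficients is zero exactly when `p` divides them all: by
    -- `act-wrap`, periodic sequences test it as well as arbitrary ones.
    _≈0? : ∀ f → Dec (f ≈ [])
    f ≈0? with reduce f
    ... | v , f≈v = map′
      (λ all → ≈-trans f≈v (All⇒≈0 (toList v) all))
      (λ f≈0 → vanishing⇒All (toList v) λ u → ≋-trans (≋-reflexive (sym (act-wrap v u 0 ℕ.≤-refl)))
        (on (≈-trans (≈-sym f≈v) f≈0) (wrap-periodic u) 0))
      (All.all? (λ c → map′ mod≡ mod (c % p ℕ.≟ 0 % p)) (toList v))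

    -- Only sequences vanishing below D see just the leading term, which must be X^D.
    Monic : ℕ → List ℕ → Set
    Monic D f = ∀ u j → (∀ i → i < D → u (j + i) ≋ 0) → act f u j ≋ u (j + D)

    monic-one : Monic 0 one
    monic-one u j _ = ≋-reflexive (trans (act-one u j) (cong u (sym (ℕ.+-identityʳ j))))

    -- If `u` vanishes on the first `D + E` places from `j`, then `act g u` vanishes on the first
    -- `D` and takes at `j + D` the value of `u` at `j + D + E`.
    monic-⊠ : ∀ {D E f g} → Monic D f → Monic E g → Monic (D + E) (f ⊠ g)
    monic-⊠ {D} {E} {f} {g} monic-f monic-g u j low =
      ≋-trans (≋-reflexive (act-⊠ f g u j))
        (≋-trans (monic-f (act g u) j λ i i<D → ≋-trans (at i (ℕ.<⇒≤ i<D)) (≋-trans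
            (≋-reflexive (cong u (ℕ.+-assoc j i E))) (low (i + E) (ℕ.+-monoˡ-< E i<D))))
          (≋-trans (at D ℕ.≤-refl) (≋-reflexive (cong u (ℕ.+-assoc j D E)))))
      where
      at : ∀ i → i ≤ D → act g u (j + i) ≋ u (j + i + E)
      at i i≤D = monic-g u (j + i) λ e e<E →
        ≋-trans (≋-reflexive (cong u (ℕ.+-assoc j i e))) (low (i + e) (ℕ.+-mono-≤-< i≤D e<E))

    monic-X^m-X : ∀ {m} → 1 < m → Monic m (X ^ m ⊞ negate X)
    monic-X^m-X {m} 1<m u j low = ≋-trans (≋-reflexive (trans (act-⊞ (X ^ m) (negate X) u j)
      (cong₂ _+_ (act-X^ m u j) (trans (act-scale (pred p) X u j) (cong (pred p *_) (act-X u j))))))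
      (≋-trans (≋-+ {u (j + m)} ≋-refl (≋-trans (≋-*ˡ (pred p) (≋-trans
        (≋-reflexive (cong u (ℕ.+-comm 1 j))) (low 1 1<m))) (≋-reflexive (ℕ.*-zeroʳ (pred p)))))
        (≋-reflexive (ℕ.+-identityʳ _)))

    -- The periodic sequence with a single 1 in each period, at place `D`, is sent to a sequence
    -- with value 1 at 0.
    monic⇒≉0 : 1 < p → ∀ {D f} → D < N → Monic D f → ¬ f ≈ []
    monic⇒≉0 1<p {D} {f} D<N monic f≈0 = ℕ.1+n≢0 (trans (sym (ℕ.m<n⇒m%n≡m 1<p))
      (trans (mod 1≋0) (ℕ.m<n⇒m%n≡m (ℕ.<-trans ℕ.z<s 1<p))))
      where
      peak : Seq
      peak i with i ℕ.≟ D
      ... | yes _ = 1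
      ... | no _ = 0
      peak-D : peak D ≡ 1
      peak-D with D ℕ.≟ D
      ... | yes _ = refl
      ... | no D≢D = contradiction refl D≢D
      peak-≢ : ∀ {i} → i ≢ D → peak i ≡ 0
      peak-≢ {i} i≢D with i ℕ.≟ D
      ... | yes i≡D = contradiction i≡D i≢D
      ... | no _ = refl
      1≋0 : 1 ≋ 0
      1≋0 = ≋-trans (≋-reflexive (sym (trans (cong peak (ℕ.m<n⇒m%n≡m D<N)) peak-D)))
        (≋-trans (≋-sym (monic (wrap peak) 0 λ i i<D → ≋-reflexive (trans
          (cong peak (ℕ.m<n⇒m%n≡m (ℕ.<-trans i<D D<N))) (peak-≢ (ℕ.<⇒≢ i<D)))))
          (on f≈0 (wrap-periodic peak) 0))

-- A residue field of prime power order and its affine plane.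

module AffinePlanes where
  open import Data.List.Relation.Unary.All as All using (All; []; _∷_)
  import Data.Sum as Sum
  open FiniteFields
  open PrimeCharacteristic
  open ShiftAlgebras

  module Minimal (R : CommutativeRing 0ℓ 0ℓ) where
    open CommutativeRing R renaming (zero to *-zero)
    open import Algebra.Properties.Semiring.Exp semiring
    open import Algebra.Solver.Ring.NaturalCoefficients.Default commutativeSemiring
      using (solve; _:=_; _:*_)
    open import Relation.Binary.Reasoning.Setoid setoid

    module _ (N : ℕ) (x^[2+N]≈x : ∀ x → x ^ suc (suc N) ≈ x) (_≈0? : ∀ x → Dec (x ≈ 0#)) where

      -- f generates a minimal ideal among those generated by products of powers of g and the xs.
      minimal : ∀ g → ¬ g ≈ 0# → (xs : List Carrier) → ∃ λ f → ¬ f ≈ 0# × f * g ^ suc N ≈ f ×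
        All (λ x → f * x ≈ 0# ⊎ f * x ^ suc N ≈ f) xs
      minimal g g≉0 [] = g , g≉0 , x^[2+N]≈x g , []
      minimal g g≉0 (x ∷ xs) with minimal g g≉0 xs
      -- `x ^ suc N` is an idempotent generating the same ideal as `x`. Either it kills `f`, or `f`
      -- is replaced by the product, on which it acts as 1.
      ... | f , f≉0 , fg≈f , all with (f * x ^ suc N) ≈0?
      ... | yes fx^N≈0 = f , f≉0 , fg≈f , inj₁ (begin
              f * x                     ≈⟨ *-congˡ (x^[2+N]≈x x) ⟨
              f * (x * x ^ suc N)       ≈⟨ solve 3 (λ f x y → f :* (x :* y) := f :* y :* x) refl f x (x ^ suc N) ⟩
              f * x ^ suc N * x         ≈⟨ trans (*-congʳ fx^N≈0) (zeroˡ x) ⟩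
              0#                        ∎) ∷ all
      ... | no fx^N≉0 = f * x ^ suc N , fx^N≉0 , swap fg≈f ,
              inj₂ (begin
                f * (x * x ^ N) * (x * x ^ N)
                  ≈⟨ solve 3 (λ f x y → f :* (x :* y) :* (x :* y) := f :* (y :* (x :* (x :* y)))) refl f x (x ^ N) ⟩
                f * (x ^ N * x ^ suc (suc N))    ≈⟨ *-congˡ (*-congˡ (x^[2+N]≈x x)) ⟩
                f * (x ^ N * x)                  ≈⟨ *-congˡ (*-comm _ x) ⟩
                f * x ^ suc N                    ∎)
              ∷ All.map (Sum.map (λ fb≈0 → trans (solve 3 (λ f y b → f :* y :* b := f :* b :* y) refl f _ _)
                   (trans (*-congʳ fb≈0) (zeroˡ _))) swap) all
        where
        swap : ∀ {b} → f * b ≈ f → f * x ^ suc N * b ≈ f * x ^ suc N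
        swap {b} fb≈f = trans (solve 3 (λ f y b → f :* y :* b := f :* b :* y) refl f _ b) (*-congʳ fb≈f)

  module AnnihilatorQuotient (R : CommutativeRing 0ℓ 0ℓ) (f : CommutativeRing.Carrier R) where
    open CommutativeRing R renaming (zero to *-zero)
    open import Algebra.Properties.Semiring.Exp semiring
    open import Algebra.Properties.Semiring.Mult semiring using () renaming (_×_ to _×ᴿ_)
    open import Algebra.Properties.Ring ring using (-‿distribʳ-*)

    infix 4 _~_
    -- Congruence modulo the annihilator of `f`. If `f` generates a minimal ideal, the quotient is a
    -- field.
    record _~_ (a b : Carrier) : Set where
      constructor scaled
      field unscaled : f * a ≈ f * b
    open _~_ public

    ~-trans : ∀ {a b c} → a ~ b → b ~ c → a ~ c
    ~-trans (scaled e) (scaled e′) = scaled (trans e e′)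

    ~-reflexive : ∀ {a b} → a ≈ b → a ~ b
    ~-reflexive a≈b = scaled (*-congˡ a≈b)

    *-~-congʳ : ∀ {a b} c → a ~ b → a * c ~ b * c
    *-~-congʳ c (scaled e) = scaled (trans (sym (*-assoc f _ c)) (trans (*-congʳ e) (*-assoc f _ c)))

    quotientRing : CommutativeRing 0ℓ 0ℓ
    quotientRing = record
      { Carrier = Carrier ; _≈_ = _~_ ; _+_ = _+_ ; _*_ = _*_ ; -_ = -_ ; 0# = 0# ; 1# = 1#
      ; isCommutativeRing = record
        { isRing = record
          { +-isAbelianGroup = record
            { isGroup = record
              { isMonoid = record
                { isSemigroup = record
                  { isMagma = record
                    { isEquivalence = record
                      { refl = scaled refl
                      ; sym = λ (scaled e) → scaled (sym e)
                      ; trans = ~-trans }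
                    ; ∙-cong = λ (scaled e) (scaled e′) →
                        scaled (trans (distribˡ f _ _) (trans (+-cong e e′) (sym (distribˡ f _ _)))) }
                  ; assoc = λ a b c → ~-reflexive (+-assoc a b c) }
                ; identity = ~-reflexive ∘ +-identityˡ , ~-reflexive ∘ +-identityʳ }
              ; inverse = ~-reflexive ∘ -‿inverseˡ , ~-reflexive ∘ -‿inverseʳ
              ; ⁻¹-cong = λ (scaled e) →
                  scaled (trans (sym (-‿distribʳ-* f _)) (trans (-‿cong e) (-‿distribʳ-* f _))) }
            ; comm = λ a b → ~-reflexive (+-comm a b) }
          ; *-cong = λ {a} {b} {c} {d} a~b c~d → ~-trans (*-~-congʳ c a~b)
              (~-trans (~-reflexive (*-comm b c)) (~-trans (*-~-congʳ b c~d) (~-reflexive (*-comm d b))))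
          ; *-assoc = λ a b c → ~-reflexive (*-assoc a b c)
          ; *-identity = ~-reflexive ∘ *-identityˡ , ~-reflexive ∘ *-identityʳ
          ; distrib = (λ a b c → ~-reflexive (distribˡ a b c)) , (λ a b c → ~-reflexive (distribʳ a b c)) }
        ; *-comm = λ a b → ~-reflexive (*-comm a b) } }

    private
      module Q = CommutativeRing quotientRing
      open import Algebra.Properties.Semiring.Exp Q.semiring using () renaming (_^_ to _^ꟴ_)
      open import Algebra.Properties.Semiring.Mult Q.semiring using () renaming (_×_ to _×ꟴ_)

    ^-quotient : ∀ a m → a ^ꟴ m ≡ a ^ m
    ^-quotient a zero = ≡.refl
    ^-quotient a (suc m) = ≡.cong (a *_) (^-quotient a m)

    ×-quotient : ∀ m a → m ×ꟴ a ≡ m ×ᴿ a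
    ×-quotient zero a = ≡.refl
    ×-quotient (suc m) a = ≡.cong (a +_) (×-quotient m a)

  -- Strength 2 and index 1.
  OrthogonalArray : ℕ → ℕ → Set
  OrthogonalArray n l = ∃ λ (word : Fin n × Fin n → Fin l → Fin n) →
    ∀ {x y i j} → i ≢ j → word x i ≡ word y i → word x j ≡ word y j → x ≡ y

  module PrimePower (p : ℕ) (pp : Prime p) (k N′ : ℕ) (p^k≡2+N′ : p ℕ.^ suc k ≡ suc (suc N′)) where
    private instance _ = prime⇒nonZero pp

    open ShiftAlgebra p N′
    private module A = CommutativeRing commutativeRing
    open A using (_+_; _*_; -_; _-_; 0#; 1#)
    open Frobenius commutativeRing p pp using (frobenius-+; frobenius-×; ^-distrib-*)

    1<p : 1 < p
    1<p = ℕ.nonTrivial⇒n>1 p {{prime⇒nonTrivial pp}}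

    -- In Horner form the power falls on prime-field coefficients, which it fixes, and on `X`, where
    -- the exponent is `N + 1` and X^N = 1.
    a^p^k≈a : ∀ a → a ^ (p ℕ.^ suc k) ≈ a
    a^p^k≈a [] = Frobenius.0^p^k≈0 commutativeRing p pp p×1≈0 (suc k)
    a^p^k≈a (c ∷ a) = begin
      (c ∷ a) ^ n                         ≈⟨ ^-congˡ n (horner c a) ⟩
      (c ×ᴿ 1# + X * a) ^ n               ≈⟨ frobenius-+ p×1≈0 (suc k) _ _ ⟩
      (c ×ᴿ 1#) ^ n + (X * a) ^ n         ≈⟨ A.+-cong (frobenius-× p×1≈0 (suc k) c) (^-distrib-* X a n) ⟩
      c ×ᴿ 1# + X ^ n * a ^ n
        ≈⟨ A.+-congˡ {c ×ᴿ 1#} (A.*-cong (A.trans (^-congʳ X p^k≡2+N′) X^[1+N]≈X) (a^p^k≈a a)) ⟩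
      c ×ᴿ 1# + X * a                     ≈⟨ horner c a ⟨
      c ∷ a                               ∎
      where
      open import Relation.Binary.Reasoning.Setoid A.setoid
      n = p ℕ.^ suc k

    frobeniusDifference : ℕ → List ℕ
    frobeniusDifference d = X ^ (p ℕ.^ d) - X

    differenceProduct : ℕ → List ℕ
    differenceProduct zero = 1#
    differenceProduct (suc d) = frobeniusDifference (suc d) * differenceProduct d

    degree : ℕ → ℕ
    degree zero = 0
    degree (suc d) = p ℕ.^ suc d ℕ.+ degree d

    monic-product : ∀ d → Monic (degree d) (differenceProduct d)
    monic-product zero = monic-one
    monic-product (suc d) = monic-⊠ {p ℕ.^ suc d} {degree d} {frobeniusDifference (suc d)} {differenceProduct d}
      (monic-X^m-X (ℕ.^-monoʳ-< p 1<p (ℕ.z<s {d}))) (monic-product d)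

    -- The degree is the geometric sum p + ... + p^d. The margin of 2 puts `degree k` strictly below
    -- `N`, which is `p ^ suc k − 1`.
    degree-bound : ∀ d → suc (suc (degree d)) ≤ p ℕ.^ suc d
    degree-bound zero = ≡.subst (2 ≤_) (≡.sym (ℕ.*-identityʳ p)) 1<p
    degree-bound (suc d) = begin
      2 ℕ.+ (p ℕ.^ suc d ℕ.+ degree d)
        ≡⟨ solve 2 (λ a b → con 2 :+ (a :+ b) := a :+ (con 2 :+ b)) ≡.refl (p ℕ.^ suc d) (degree d) ⟩
      p ℕ.^ suc d ℕ.+ (2 ℕ.+ degree d)        ≤⟨ ℕ.+-monoʳ-≤ (p ℕ.^ suc d) (degree-bound d) ⟩
      p ℕ.^ suc d ℕ.+ p ℕ.^ suc d             ≡⟨ ≡.cong (p ℕ.^ suc d ℕ.+_) (ℕ.+-identityʳ _) ⟨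
      2 ℕ.* p ℕ.^ suc d                       ≤⟨ ℕ.*-monoˡ-≤ (p ℕ.^ suc d) 1<p ⟩
      p ℕ.* p ℕ.^ suc d                       ∎
      where
      open ℕ.≤-Reasoning
      open import Data.Nat.Solver using (module +-*-Solver)
      open +-*-Solver

    product≉0 : ¬ differenceProduct k ≈ 0#
    product≉0 = monic⇒≉0 1<p {degree k}
      (ℕ.≤-pred (ℕ.≤-trans (degree-bound k) (ℕ.≤-reflexive p^k≡2+N′))) (monic-product k)

    annihilates-product : ∀ f e d → 0 < e → e ≤ d →
      f * frobeniusDifference e ≈ 0# → f * differenceProduct d ≈ 0#
    annihilates-product f e zero 0<e e≤0 _ = contradiction (ℕ.<-≤-trans 0<e e≤0) λ ()
    annihilates-product f e (suc d) 0<e e≤1+d f≈0 with e ℕ.≟ suc d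
    ... | yes ≡.refl = A.trans (A.sym (A.*-assoc f (frobeniusDifference e) (differenceProduct d)))
      (A.trans (A.*-congʳ {differenceProduct d} f≈0) (A.zeroˡ (differenceProduct d)))
    ... | no e≢1+d = begin
      f * (D * P)     ≈⟨ A.*-congˡ {f} (A.*-comm D P) ⟩
      f * (P * D)     ≈⟨ A.*-assoc f P D ⟨
      f * P * D       ≈⟨ A.*-congʳ {D} (annihilates-product f e d 0<e (ℕ.≤-pred (ℕ.≤∧≢⇒< e≤1+d e≢1+d)) f≈0) ⟩
      0# * D          ≈⟨ A.zeroˡ D ⟩
      0#              ∎
      where
      open import Relation.Binary.Reasoning.Setoid A.setoid
      D = frobeniusDifference (suc d)
      P = differenceProduct d

    module Plane (f : List ℕ) (f*product≉0 : ¬ f * differenceProduct k ≈ 0#)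
      (annihilated⊎unit : ∀ a → f * a ≈ 0# ⊎ f * a ^ suc N′ ≈ f) where
      open AnnihilatorQuotient commutativeRing f
      private
        module K = CommutativeRing quotientRing
        open import Algebra.Properties.Semiring.Exp K.semiring using () renaming (_^_ to _^ꟴ_)
        open import Algebra.Properties.Semiring.Mult K.semiring using () renaming (_×_ to _×ꟴ_)
        open import Algebra.Properties.Group A.+-group using (x∙y⁻¹≈ε⇒x≈y; x≈y⇒x∙y⁻¹≈ε)
        open import Algebra.Properties.Ring A.ring using (x[y-z]≈xy-xz)

      _~?_ : ∀ a b → Dec (a ~ b)
      a ~? b = map′ (λ e → scaled (x∙y⁻¹≈ε⇒x≈y (f * a) (f * b) e)) (λ e → x≈y⇒x∙y⁻¹≈ε (unscaled e)) ((f * a - f * b) ≈0?)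

      1≁0 : ¬ 1# ~ 0#
      1≁0 (scaled e) = f*product≉0 (A.trans (A.*-congʳ {differenceProduct k} (A.trans (A.sym (A.*-identityʳ f)) (A.trans e (A.zeroʳ f))))
        (A.zeroˡ (differenceProduct k)))

      p×1~0 : p ×ꟴ 1# ~ 0#
      p×1~0 = ≡.subst (_~ 0#) (≡.sym (×-quotient p 1#)) (~-reflexive p×1≈0)

      root-of-unity : ∀ a → a ~ 0# ⊎ a ^ꟴ suc N′ ~ 1#
      root-of-unity a with annihilated⊎unit a
      ... | inj₁ fa≈0 = inj₁ (scaled (A.trans fa≈0 (A.sym (A.zeroʳ f))))
      ... | inj₂ fa≈f = inj₂ (≡.subst (_~ 1#) (≡.sym (^-quotient a (suc N′)))
        (scaled (A.trans fa≈f (A.sym (A.*-identityʳ f)))))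

      -- Otherwise `f` would annihilate one factor of the difference product, hence the whole
      -- product.
      X-large : ∀ d → 0 < d → d < suc k → ¬ X ^ꟴ (p ℕ.^ d) ~ X
      X-large d 0<d d≤k eq = f*product≉0 (annihilates-product f d k 0<d (ℕ.≤-pred d≤k)
        (A.trans (x[y-z]≈xy-xz f (X ^ (p ℕ.^ d)) X) (x≈y⇒x∙y⁻¹≈ε
          (unscaled (≡.subst (_~ X) (^-quotient X (p ℕ.^ d)) eq)))))

      open FiniteField.Elements quotientRing p pp (suc k) N′ p^k≡2+N′ p×1~0 1≁0
        _~?_ root-of-unity X X-large public using (line; line-unique)

    -- The minimisation starts at the difference product `P`, so that `f * P ^ suc N′ ≈ f` keeps
    -- `f * P` nonzero. It runs over all elements, so that each is zero or a unit in the quotient.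
    plane : OrthogonalArray (p ℕ.^ suc k) (suc (p ℕ.^ suc k))
    plane with Minimal.minimal commutativeRing N′
      (λ a → A.trans (^-congʳ a (≡.sym p^k≡2+N′)) (a^p^k≈a a)) _≈0? (differenceProduct k) product≉0 elements
    ... | f , f≉0 , fP^N≈f , all = line , λ {x} {y} → line-unique {x} {y}
      where
      P = differenceProduct k
      f*product≉0 : ¬ f * P ≈ 0#
      f*product≉0 fP≈0 = f≉0 (A.trans (A.sym fP^N≈f) (A.trans (A.sym (A.*-assoc f P (P ^ N′)))
        (A.trans (A.*-congʳ {P ^ N′} fP≈0) (A.zeroˡ (P ^ N′)))))
      dichotomy : ∀ a → f * a ≈ 0# ⊎ f * a ^ suc N′ ≈ f
      dichotomy a with elements-complete a
      ... | b , b∈ , a≈b with All.lookup all b∈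
      ... | inj₁ fb≈0 = inj₁ (A.trans (A.*-congˡ {f} a≈b) fb≈0)
      ... | inj₂ fb≈f = inj₂ (A.trans (A.*-congˡ {f} (^-congˡ (suc N′) a≈b)) fb≈f)
      open Plane f f*product≉0 dichotomy

  affinePlane : ∀ {n} → IsPrimePower n → OrthogonalArray n (suc n)
  affinePlane (p , suc k , pp , _ , ≡.refl) = plane
    where
    2≤p^k : 2 ≤ p ℕ.^ suc k
    2≤p^k = ℕ.^-monoʳ-< p (ℕ.nonTrivial⇒n>1 p {{prime⇒nonTrivial pp}}) (ℕ.z<s {k})
    open PrimePower p pp k (p ℕ.^ suc k ∸ 2) (≡.sym (ℕ.m+[n∸m]≡n 2≤p^k))

-- Double counting, pigeonhole, and pairwise intersecting edges.

module Counting where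
  open import Algebra.Properties.CommutativeMonoid.Sum ℕ.+-0-commutativeMonoid using (sum; ∑-comm; sum-cong-≗)
  open import Data.Bool using (true; false; if_then_else_)
  open import Data.Fin.Subset using (Subset; _∈_; ∣_∣)
  open import Data.Fin.Subset.Properties using (_∈?_)
  open import Data.List using (_++_; map; length; lookup; allFin)
  import Data.List.Membership.Propositional as List
  open import Data.List.Membership.Propositional.Properties using (∈-map⁺; ∈-++⁺ˡ; ∈-++⁺ʳ; ∈-allFin)
  import Data.List.Properties as List
  open import Data.List.Relation.Unary.Any using (here; there; index)
  open import Data.List.Relation.Unary.Any.Properties using (lookup-index)
  import Data.Product.Properties as Product
  open import Data.Vec using ([]; _∷_; tabulate)
  open import Data.Vec.Properties using (lookup∘tabulate; lookup⇒[]=; []=⇒lookup)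
  open import Relation.Unary using (Decidable; U)
  open import Relation.Unary.Properties using (U?)
  open import Data.Fin using (zero; suc; punchIn; punchOut; combine; remQuot)
  open import Data.Nat using (_+_; _*_)
  open import Relation.Binary.PropositionalEquality using (refl; sym; trans; cong; cong₂; subst)

  indicator : {A : Set} → Dec A → ℕ
  indicator A? = if does A? then 1 else 0

  indicator-≤ : {A B : Set} (A? : Dec A) (B? : Dec B) → (A → B) → indicator A? ≤ indicator B?
  indicator-≤ (no _) _ _ = z≤n
  indicator-≤ (yes _) (yes _) _ = ℕ.≤-refl
  indicator-≤ (yes a) (no ¬b) f = contradiction (f a) ¬b

  indicator-¬ : {A : Set} (A? : Dec A) → indicator A? + indicator (¬? A?) ≡ 1
  indicator-¬ (yes _) = refl
  indicator-¬ (no _) = refl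

  sum-mono : ∀ {n} {f g : Fin n → ℕ} → (∀ i → f i ≤ g i) → sum f ≤ sum g
  sum-mono {zero} f≤g = z≤n
  sum-mono {suc n} f≤g = ℕ.+-mono-≤ (f≤g zero) (sum-mono (f≤g ∘ suc))

  sum-const : ∀ n c → sum {n} (λ _ → c) ≡ n * c
  sum-const zero c = refl
  sum-const (suc n) c = cong (c +_) (sum-const n c)

  sum-*ʳ : ∀ {n} (f : Fin n → ℕ) c → sum (λ i → f i * c) ≡ sum f * c
  sum-*ʳ {zero} f c = refl
  sum-*ʳ {suc n} f c = trans (cong (f zero * c +_) (sum-*ʳ (f ∘ suc) c)) (sym (ℕ.*-distribʳ-+ c (f zero) _))

  term≤sum : ∀ {n} (f : Fin n → ℕ) i → f i ≤ sum f
  term≤sum f zero = ℕ.m≤m+n _ _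
  term≤sum f (suc i) = ℕ.≤-trans (term≤sum (f ∘ suc) i) (ℕ.m≤n+m _ _)

  count : ∀ {n} {P : Fin n → Set} → Decidable P → ℕ
  count P? = sum (λ i → indicator (P? i))

  count-≤1 : ∀ {n} {P : Fin n → Set} (P? : Decidable P) → (∀ i j → P i → P j → i ≡ j) → count P? ≤ 1
  count-≤1 {zero} P? unique = z≤n
  count-≤1 {suc n} {P} P? unique with P? zero
  ... | no _ = count-≤1 (P? ∘ suc) λ i j Pi Pj → Fin.suc-injective (unique _ _ Pi Pj)
  ... | yes P0 = ℕ.≤-reflexive (cong suc (trans (sum-cong-≗ none) (trans (sum-const n 0) (ℕ.*-zeroʳ n))))
    where
    none : ∀ i → indicator (P? (suc i)) ≡ 0
    none i with P? (suc i)
    ... | no _ = refl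
    ... | yes Pi = contradiction (unique _ _ P0 Pi) λ ()

  -- Double counting of the pairs `(i , j)` with `Q j` and `R i j`: at least one for each `i` in
  -- `P`, at most one for each `j` in `Q`.
  count-matching : ∀ {a b} {P : Fin a → Set} {Q : Fin b → Set} {R : Fin a → Fin b → Set}
    (P? : Decidable P) (Q? : Decidable Q) (R? : ∀ i j → Dec (R i j)) →
    (∀ i → P i → ∃ λ j → Q j × R i j) → (∀ i i′ j → R i j → R i′ j → i ≡ i′) →
    count P? ≤ count Q?
  count-matching {a} {b} {P} {Q} {R} P? Q? R? total unique = begin
    count P?                                                    ≤⟨ sum-mono total-≤ ⟩
    sum (λ i → sum (λ j → indicator (Q? j ×-dec R? i j)))       ≡⟨ ∑-comm (λ i j → indicator (Q? j ×-dec R? i j)) ⟩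
    sum (λ j → sum (λ i → indicator (Q? j ×-dec R? i j)))       ≤⟨ sum-mono unique-≤ ⟩
    count Q?                                                    ∎
    where
    open ℕ.≤-Reasoning
    total-≤ : ∀ i → indicator (P? i) ≤ sum (λ j → indicator (Q? j ×-dec R? i j))
    total-≤ i with P? i
    ... | no _ = z≤n
    ... | yes Pi with total i Pi
    ... | j , Qj , Rij = ℕ.≤-trans (indicator-≤ (yes Pi) (Q? j ×-dec R? i j) λ _ → Qj , Rij)
      (term≤sum (λ j → indicator (Q? j ×-dec R? i j)) j)
    unique-≤ : ∀ j → sum (λ i → indicator (Q? j ×-dec R? i j)) ≤ indicator (Q? j)
    unique-≤ j with Q? j
    ... | yes _ = count-≤1 (λ i → R? i j) λ i i′ Rij Ri′j → unique i i′ j Rij Ri′j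
    ... | no _ = ℕ.≤-reflexive (trans (sum-const a 0) (ℕ.*-zeroʳ a))

  every : ∀ {n} → Decidable {A = Fin n} U
  every = U?

  count-every : ∀ n → count (every {n}) ≡ n
  count-every n = trans (sum-const n 1) (ℕ.*-identityʳ n)

  count-injective : ∀ {a b} {P : Fin a → Set} (P? : Decidable P) (h : Fin a → Fin b) →
    (∀ i j → P i → P j → h i ≡ h j → i ≡ j) → count P? ≤ b
  count-injective {b = b} P? h inj = ℕ.≤-trans
    (count-matching P? every (λ i j → P? i ×-dec (h i Fin.≟ j)) (λ i Pi → h i , _ , Pi , refl)
      (λ { i i′ j (Pi , refl) (Pi′ , e) → inj i i′ Pi Pi′ (sym e) }))
    (ℕ.≤-reflexive (count-every b))

  ∣p∣≡count : ∀ {n} (p : Subset n) → ∣ p ∣ ≡ count (_∈? p)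
  ∣p∣≡count [] = refl
  ∣p∣≡count (true ∷ p) = cong suc (trans (∣p∣≡count p) (sum-cong-≗ λ i → indicator-drop i))
    where
    indicator-drop : ∀ i → indicator (i ∈? p) ≡ indicator (suc i ∈? (true ∷ p))
    indicator-drop i with i ∈? p
    ... | yes _ = refl
    ... | no _ = refl
  ∣p∣≡count (false ∷ p) = trans (∣p∣≡count p) (sum-cong-≗ λ i → indicator-drop i)
    where
    indicator-drop : ∀ i → indicator (i ∈? p) ≡ indicator (suc i ∈? (false ∷ p))
    indicator-drop i with i ∈? p
    ... | yes _ = refl
    ... | no _ = refl

  injective⇒≤∣p∣ : ∀ {a n} (p : Subset n) (g : Fin a → Fin n) → (∀ {i j} → g i ≡ g j → i ≡ j) →
    (∀ i → g i ∈ p) → a ≤ ∣ p ∣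
  injective⇒≤∣p∣ {a} p g g-inj g∈p = begin
    a                ≡⟨ count-every a ⟨
    count (every {a}) ≤⟨ count-matching every (_∈? p) (λ i x → g i Fin.≟ x) (λ i _ → g i , g∈p i , refl)
                          (λ { i i′ x refl e → g-inj (sym e) }) ⟩
    count (_∈? p)    ≡⟨ ∣p∣≡count p ⟨
    ∣ p ∣            ∎
    where open ℕ.≤-Reasoning

  pigeonhole-∈ : ∀ {a n} (p : Subset n) (g : Fin a → Fin n) → (∀ i → g i ∈ p) → ∣ p ∣ < a →
    ∃₂ λ i j → i ≢ j × g i ≡ g j
  pigeonhole-∈ p g g∈p ∣p∣<a with Fin.any? (λ i → Fin.any? (λ j → ¬? (i Fin.≟ j) ×-dec (g i Fin.≟ g j)))
  ... | yes collision = collision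
  ... | no injective = contradiction (injective⇒≤∣p∣ p g g-inj g∈p) (ℕ.<⇒≱ ∣p∣<a)
    where
    g-inj : ∀ {i j} → g i ≡ g j → i ≡ j
    g-inj {i} {j} e with i Fin.≟ j
    ... | yes i≡j = i≡j
    ... | no i≢j = contradiction (i , j , i≢j , e) injective

  image : ∀ {a n} → (Fin a → Fin n) → Subset n
  image g = tabulate λ x → does (Fin.any? λ i → g i Fin.≟ x)

  ∈-image⁺ : ∀ {a n} (g : Fin a → Fin n) i → g i ∈ image g
  ∈-image⁺ g i = lookup⇒[]= (g i) (image g) (trans (lookup∘tabulate _ (g i)) (dec-true (Fin.any? λ j → g j Fin.≟ g i) (i , refl)))

  ∈-image⁻ : ∀ {a n} (g : Fin a → Fin n) {x} → x ∈ image g → ∃ λ i → g i ≡ x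
  ∈-image⁻ g {x} x∈ with Fin.any? (λ i → g i Fin.≟ x) | trans (sym (lookup∘tabulate (λ x → does (Fin.any? λ i → g i Fin.≟ x)) x)) ([]=⇒lookup x∈)
  ... | yes found | _ = found
  ... | no _ | ()

  ∣image∣≤ : ∀ {a n} (g : Fin a → Fin n) → ∣ image g ∣ ≤ a
  ∣image∣≤ {a} g = begin
    ∣ image g ∣        ≡⟨ ∣p∣≡count (image g) ⟩
    count (_∈? image g) ≤⟨ count-matching (_∈? image g) every (λ x i → g i Fin.≟ x)
                            (λ x x∈ → let i , e = ∈-image⁻ g x∈ in i , _ , e)
                            (λ { x x′ i e e′ → trans (sym e) e′ }) ⟩
    count (every {a})   ≡⟨ count-every a ⟩
    a                  ∎
    where open ℕ.≤-Reasoning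

  -- The ordered pairs off the diagonal, which `punchIn` skips. Every unordered pair occurs twice,
  -- so that no division by 2 is involved.
  arc : ∀ {m} → Fin (suc m * m) → Fin (suc m) × Fin (suc m)
  arc {m} t = let j , k = remQuot m t in j , punchIn j k

  arc-distinct : ∀ {m} (t : Fin (suc m * m)) → proj₁ (arc t) ≢ proj₂ (arc t)
  arc-distinct {m} t e = Fin.punchInᵢ≢i (proj₁ (remQuot {suc m} m t)) _ (sym e)

  arc-injective : ∀ {m} {s t : Fin (suc m * m)} → arc s ≡ arc t → s ≡ t
  arc-injective {m} {s} {t} e = trans (sym (Fin.combine-remQuot {suc m} m s))
    (trans (cong (uncurry combine) (pair (remQuot {suc m} m s) (remQuot {suc m} m t) e)) (Fin.combine-remQuot {suc m} m t))
    where
    pair : ∀ (x y : Fin (suc m) × Fin m) → (proj₁ x , punchIn (proj₁ x) (proj₂ x)) ≡ (proj₁ y , punchIn (proj₁ y) (proj₂ y)) → x ≡ y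
    pair (j , k) (j′ , k′) e with Product.,-injectiveˡ e
    ... | refl = cong (j ,_) (Fin.punchIn-injective j k k′ (Product.,-injectiveʳ e))

  module _ {m : ℕ} (E : Fin (suc m) → Fin (suc m) → Set) (E? : ∀ j k → Dec (E j k))
    (E-sym : ∀ {j k} → E j k → E k j) (E-irrefl : ∀ {j} → ¬ E j j)
    (E-meet : ∀ {j k j′ k′} → E j k → E j′ k′ → (j ≡ j′ ⊎ j ≡ k′) ⊎ (k ≡ j′ ⊎ k ≡ k′))
    where

    arcs : ℕ
    arcs = count (λ t → uncurry E? (arc {m} t))

    arcs≤length : (L : List (Fin (suc m) × Fin (suc m))) → (∀ {j k} → E j k → (j , k) List.∈ L) → arcs ≤ length L
    arcs≤length L complete = ℕ.≤-trans
      (count-matching (λ t → uncurry E? (arc t)) every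
        (λ t i → Product.≡-dec Fin._≟_ Fin._≟_ (arc t) (lookup L i))
        (λ t e → index (complete e) , _ , lookup-index (complete e))
        (λ t t′ i e e′ → arc-injective (trans e (sym e′))))
      (ℕ.≤-reflexive (count-every (length L)))

    -- At most `m` arcs leave the centre `a` and at most `m` enter it.
    star⇒arcs≤ : ∀ a → (∀ {j k} → E j k → j ≡ a ⊎ k ≡ a) → arcs ≤ m + m
    star⇒arcs≤ a star = ℕ.≤-trans (arcs≤length (map (a ,_) others ++ map (_, a) others) complete)
      (ℕ.≤-reflexive (trans (List.length-++ (map (a ,_) others)) (cong₂ _+_
        (trans (List.length-map (a ,_) others) others-length)
        (trans (List.length-map (_, a) others) others-length))))
      where
      others = map (punchIn a) (allFin m)
      others-length : length others ≡ m
      others-length = trans (List.length-map (punchIn a) (allFin m)) (List.length-tabulate id)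
      other : ∀ {k} → a ≢ k → k List.∈ others
      other a≢k = subst (List._∈ others) (Fin.punchIn-punchOut a≢k) (∈-map⁺ (punchIn a) (∈-allFin (punchOut a≢k)))
      complete : ∀ {j k} → E j k → (j , k) List.∈ (map (a ,_) others ++ map (_, a) others)
      complete {j} {k} e with star e
      ... | inj₁ refl = ∈-++⁺ˡ (∈-map⁺ (a ,_) (other λ { refl → E-irrefl e }))
      ... | inj₂ refl = ∈-++⁺ʳ (map (a ,_) others) (∈-map⁺ (_, a) (other λ { refl → E-irrefl e }))

    -- An edge meeting all three sides of a triangle joins two of its corners, so it is itself a
    -- side.
    triangle⇒arcs≤ : ∀ a b x → E a b → E a x → E b x → arcs ≤ 6
    triangle⇒arcs≤ a b x ab ax bx = arcs≤length
      ((a , b) ∷ (b , a) ∷ (a , x) ∷ (x , a) ∷ (b , x) ∷ (x , b) ∷ []) complete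
      where
      a≢b : a ≢ b
      a≢b refl = E-irrefl ab
      a≢x : a ≢ x
      a≢x refl = E-irrefl ax
      b≢x : b ≢ x
      b≢x refl = E-irrefl bx
      complete : ∀ {j k} → E j k → (j , k) List.∈ ((a , b) ∷ (b , a) ∷ (a , x) ∷ (x , a) ∷ (b , x) ∷ (x , b) ∷ [])
      complete e with E-meet e ab | E-meet e ax | E-meet e bx
      ... | inj₁ (inj₁ refl) | _ | inj₁ (inj₁ refl) = contradiction refl a≢b
      ... | inj₁ (inj₁ refl) | _ | inj₁ (inj₂ refl) = contradiction refl a≢x
      ... | inj₁ (inj₁ refl) | _ | inj₂ (inj₁ refl) = here refl
      ... | inj₁ (inj₁ refl) | _ | inj₂ (inj₂ refl) = there (there (here refl))
      ... | inj₁ (inj₂ refl) | inj₁ (inj₁ refl) | _ = contradiction refl a≢b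
      ... | inj₁ (inj₂ refl) | inj₁ (inj₂ refl) | _ = contradiction refl b≢x
      ... | inj₁ (inj₂ refl) | inj₂ (inj₁ refl) | _ = there (here refl)
      ... | inj₁ (inj₂ refl) | inj₂ (inj₂ refl) | _ = there (there (there (there (here refl))))
      ... | inj₂ (inj₁ refl) | _ | inj₁ (inj₁ refl) = there (here refl)
      ... | inj₂ (inj₁ refl) | _ | inj₁ (inj₂ refl) = there (there (there (here refl)))
      ... | inj₂ (inj₁ refl) | _ | inj₂ (inj₁ refl) = contradiction refl a≢b
      ... | inj₂ (inj₁ refl) | _ | inj₂ (inj₂ refl) = contradiction refl a≢x
      ... | inj₂ (inj₂ refl) | inj₁ (inj₁ refl) | _ = here refl
      ... | inj₂ (inj₂ refl) | inj₁ (inj₂ refl) | _ = there (there (there (there (there (here refl)))))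
      ... | inj₂ (inj₂ refl) | inj₂ (inj₁ refl) | _ = contradiction refl a≢b
      ... | inj₂ (inj₂ refl) | inj₂ (inj₂ refl) | _ = contradiction refl b≢x

    -- Pairwise intersecting edges form a star or a triangle.
    intersecting⇒arcs≤ : 3 ≤ m → arcs ≤ m + m
    intersecting⇒arcs≤ 3≤m with Fin.any? (λ a → Fin.any? (λ b → E? a b))
    ... | no ∄E = star⇒arcs≤ zero λ e → contradiction (_ , _ , e) ∄E
    ... | yes (a , b , ab) with Fin.any? (λ x → E? a x ×-dec E? b x)
    -- `3 ≤ m` makes the six arcs of a triangle no more than those of a full star.
    ... | yes (x , ax , bx) = ℕ.≤-trans (triangle⇒arcs≤ a b x ab ax bx) (ℕ.+-mono-≤ 3≤m 3≤m)
    ... | no ∄triangle with Fin.any? (λ x → E? a x ×-dec ¬? (x Fin.≟ b))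
    -- An edge avoiding `a` would have to join its neighbours `b` and `x`, closing a triangle.
    ... | yes (x , ax , x≢b) = star⇒arcs≤ a star
      where
      star : ∀ {j k} → E j k → j ≡ a ⊎ k ≡ a
      star e with E-meet e ab | E-meet e ax
      ... | inj₁ (inj₁ j≡a) | _ = inj₁ j≡a
      ... | inj₂ (inj₁ k≡a) | _ = inj₂ k≡a
      ... | _ | inj₁ (inj₁ j≡a) = inj₁ j≡a
      ... | _ | inj₂ (inj₁ k≡a) = inj₂ k≡a
      ... | inj₁ (inj₂ refl) | inj₁ (inj₂ refl) = contradiction refl x≢b
      ... | inj₁ (inj₂ refl) | inj₂ (inj₂ refl) = contradiction (x , ax , e) ∄triangle
      ... | inj₂ (inj₂ refl) | inj₁ (inj₂ refl) = contradiction (x , ax , E-sym e) ∄triangle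
      ... | inj₂ (inj₂ refl) | inj₂ (inj₂ refl) = contradiction refl x≢b
    -- Here `b` is the only neighbour of `a`, so an edge meeting the edge `a b` contains `b`.
    ... | no a-leaf = star⇒arcs≤ b star
      where
      only-b : ∀ {x} → E a x → x ≡ b
      only-b {x} ax with x Fin.≟ b
      ... | yes x≡b = x≡b
      ... | no x≢b = contradiction (x , ax , x≢b) a-leaf
      star : ∀ {j k} → E j k → j ≡ b ⊎ k ≡ b
      star e with E-meet e ab
      ... | inj₁ (inj₁ refl) = inj₂ (only-b e)
      ... | inj₁ (inj₂ j≡b) = inj₁ j≡b
      ... | inj₂ (inj₁ refl) = inj₁ (only-b (E-sym e))
      ... | inj₂ (inj₂ k≡b) = inj₂ k≡b

-- The upper bound on the size of a frameproof code.

module CodeUpperBound where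
  open import Algebra.Properties.CommutativeMonoid.Sum ℕ.+-0-commutativeMonoid using (sum; ∑-comm; ∑-distrib-+; sum-cong-≗)
  open import Data.Fin.Subset using (_∈_; _⊆_; ∣_∣)
  open import Data.Fin.Subset.Properties using (_∈?_)
  open Counting
  open import Data.Fin using (punchIn; punchOut; combine)
  open import Data.Nat using (_+_; _*_)
  open import Relation.Binary.PropositionalEquality using (refl; sym; trans; cong; cong₂)

  module UpperBound (q c : ℕ) (2≤c : 2 ≤ c) (C : Code q (2 + c)) (frameproof : IsFrameproof q (2 + c) c C) where

    l : ℕ
    l = 2 + c

    -- The negation of owning a subword: some other codeword agrees with x at the given coordinates.
    Shared₁ : Word q l → Fin l → Set
    Shared₁ x j = ∃ λ y → y ∈ C × y ≢ x × coord q l x j ≡ coord q l y j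

    Shared₂ : Word q l → Fin l → Fin l → Set
    Shared₂ x j k = ∃ λ y → y ∈ C × y ≢ x × coord q l x j ≡ coord q l y j × coord q l x k ≡ coord q l y k

    shared₁? : ∀ x j → Dec (Shared₁ x j)
    shared₁? x j = Fin.any? λ y → (y ∈? C) ×-dec ¬? (y Fin.≟ x) ×-dec (coord q l x j Fin.≟ coord q l y j)

    shared₂? : ∀ x j k → Dec (Shared₂ x j k)
    shared₂? x j k = Fin.any? λ y → (y ∈? C) ×-dec ¬? (y Fin.≟ x) ×-dec
      (coord q l x j Fin.≟ coord q l y j) ×-dec (coord q l x k Fin.≟ coord q l y k)

    module _ {x : Word q l} (x∈C : x ∈ C) (shared₁ : ∀ j → Shared₁ x j) where

      -- Merging two disjoint shared pairs leaves c parts, and a witness for each part gives c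
      -- codewords having x as a descendant.
      ¬two-disjoint : ∀ {j k j′ k′} → Shared₂ x j k → Shared₂ x j′ k′ →
        j ≢ k → j ≢ j′ → j ≢ k′ → k ≢ j′ → k ≢ k′ → ¬ j′ ≢ k′
      ¬two-disjoint {j} {k} {j′} {k′} (y , y∈C , y≢x , yⱼ , yₖ) (y′ , y′∈C , y′≢x , yⱼ′ , yₖ′)
        j≢k j≢j′ j≢k′ k≢j′ k≢k′ j′≢k′ =
        -- Frameproofness forces `x` to be one of the witnesses, all of which were chosen different
        -- from `x`.
        let i , e = ∈-image⁻ g x∈P in proj₁ (proj₂ (base-good (embed i))) e
        where
        base : Fin l → Word q l
        base i with i Fin.≟ j | i Fin.≟ j′
        ... | yes _ | _ = y
        ... | no _ | yes _ = y′
        ... | no _ | no _ = proj₁ (shared₁ i)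
        base-good : ∀ i → base i ∈ C × base i ≢ x × coord q l x i ≡ coord q l (base i) i
        base-good i with i Fin.≟ j | i Fin.≟ j′
        ... | yes refl | _ = y∈C , y≢x , yⱼ
        ... | no _ | yes refl = y′∈C , y′≢x , yⱼ′
        ... | no _ | no _ = proj₂ (shared₁ i)
        base-j : base j ≡ y
        base-j with j Fin.≟ j
        ... | yes _ = refl
        ... | no j≢j = contradiction refl j≢j
        base-j′ : base j′ ≡ y′
        base-j′ with j′ Fin.≟ j | j′ Fin.≟ j′
        ... | yes j′≡j | _ = contradiction (sym j′≡j) j≢j′
        ... | no _ | yes _ = refl
        ... | no _ | no j′≢j′ = contradiction refl j′≢j′
        -- The coordinates `k` and `k′` are left out, since the witnesses for `j` and `j′` also
        -- serve them; `c` of the `2 + c` coordinates remain.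
        embed : Fin c → Fin l
        embed = punchIn k ∘ punchIn (punchOut k≢k′)
        embedded : ∀ i → k ≢ i → k′ ≢ i → ∃ λ i′ → embed i′ ≡ i
        embedded i k≢i k′≢i = punchOut k″≢ , trans
          (cong (punchIn k) (Fin.punchIn-punchOut k″≢)) (Fin.punchIn-punchOut k≢i)
          where
          k″≢ : punchOut k≢k′ ≢ punchOut k≢i
          k″≢ e = k′≢i (Fin.punchOut-injective k≢k′ k≢i e)
        g : Fin c → Word q l
        g = base ∘ embed
        g∈ : ∀ i → k ≢ i → k′ ≢ i → base i ∈ image g
        g∈ i k≢i k′≢i with embedded i k≢i k′≢i
        ... | i′ , refl = ∈-image⁺ g i′
        covered : ∀ i → ∃ λ z → z ∈ image g × coord q l x i ≡ coord q l z i
        covered i with k Fin.≟ i | k′ Fin.≟ i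
        ... | yes refl | _ = base j , g∈ j (j≢k ∘ sym) (j≢k′ ∘ sym) , trans yₖ (cong (λ z → coord q l z k) (sym base-j))
        ... | no _ | yes refl = base j′ , g∈ j′ k≢j′ (j′≢k′ ∘ sym) , trans yₖ′ (cong (λ z → coord q l z k′) (sym base-j′))
        ... | no k≢i | no k′≢i = base i , g∈ i k≢i k′≢i , proj₂ (proj₂ (base-good i))
        image⊆C : image g ⊆ C
        image⊆C z∈ with ∈-image⁻ g z∈
        ... | i , refl = proj₁ (base-good (embed i))
        x∈P : x ∈ image g
        x∈P = proj₁ (frameproof (image g) image⊆C (∣image∣≤ g)) (covered , x∈C)

      Edge : Fin l → Fin l → Set
      Edge j k = j ≢ k × Shared₂ x j k

      edge? : ∀ j k → Dec (Edge j k)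
      edge? j k = ¬? (j Fin.≟ k) ×-dec shared₂? x j k

      edges-meet : ∀ {j k j′ k′} → Edge j k → Edge j′ k′ → (j ≡ j′ ⊎ j ≡ k′) ⊎ (k ≡ j′ ⊎ k ≡ k′)
      edges-meet {j} {k} {j′} {k′} (j≢k , e) (j′≢k′ , e′) = decidable-stable
        (((j Fin.≟ j′) ⊎-dec (j Fin.≟ k′)) ⊎-dec ((k Fin.≟ j′) ⊎-dec (k Fin.≟ k′)))
        λ disjoint → ¬two-disjoint e e′ j≢k (disjoint ∘ inj₁ ∘ inj₁) (disjoint ∘ inj₁ ∘ inj₂)
          (disjoint ∘ inj₂ ∘ inj₁) (disjoint ∘ inj₂ ∘ inj₂) j′≢k′

      edge-arcs≤ : count (λ t → uncurry edge? (arc {suc c} t)) ≤ suc c + suc c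
      edge-arcs≤ = intersecting⇒arcs≤ Edge edge?
        (λ (j≢k , y , y∈C , y≢x , eⱼ , eₖ) → j≢k ∘ sym , y , y∈C , y≢x , eₖ , eⱼ)
        (λ (j≢j , _) → j≢j refl) edges-meet (s≤s 2≤c)

    Owns₁ : Fin l → Word q l → Set
    Owns₁ j x = x ∈ C × ¬ Shared₁ x j

    Owns₂ : Fin (l * suc c) → Word q l → Set
    Owns₂ t x = x ∈ C × ¬ uncurry (Shared₂ x) (arc t)

    owns₁? : ∀ j x → Dec (Owns₁ j x)
    owns₁? j x = (x ∈? C) ×-dec ¬? (shared₁? x j)

    owns₂? : ∀ t x → Dec (Owns₂ t x)
    owns₂? t x = (x ∈? C) ×-dec ¬? (uncurry (shared₂? x) (arc t))

    -- Two different owners of a coordinate have different letters there.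
    owns₁-≤ : ∀ j → count (owns₁? j) ≤ q
    owns₁-≤ j = count-injective (owns₁? j) (λ x → coord q l x j)
      λ { x y (x∈C , own) (y∈C , _) e → decidable-stable (x Fin.≟ y) λ x≢y → own (y , y∈C , x≢y ∘ sym , e) }

    owns₂-≤ : ∀ t → count (owns₂? t) ≤ q * q
    owns₂-≤ t = count-injective (owns₂? t) (λ x → combine (coord q l x j) (coord q l x k))
      λ { x y (x∈C , own) (y∈C , _) e → decidable-stable (x Fin.≟ y) λ x≢y →
          let eⱼ , eₖ = Fin.combine-injective (coord q l x j) (coord q l x k) (coord q l y j) (coord q l y k) e
          in own (y , y∈C , x≢y ∘ sym , eⱼ , eₖ) }
      where
      j = proj₁ (arc t)
      k = proj₂ (arc t)

    -- Of the (c + 2)(c + 1) ordered pairs at most 2(c + 1) are shared when no single coordinate is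
    -- owned; `K` is the difference.
    K : ℕ
    K = c * suc c

    -- A codeword owning a single coordinate is paid for by the second sum alone; any other codeword
    -- owns at least `K` ordered pairs.
    owned : ∀ x → indicator (x ∈? C) * K ≤
      sum (λ t → indicator (owns₂? t x)) + sum (λ j → indicator (owns₁? j x)) * K
    owned x = go (x ∈? C) refl
      where
      open ℕ.≤-Reasoning
      go : (d : Dec (x ∈ C)) → (x ∈? C) ≡ d → indicator (x ∈? C) * K ≤
        sum (λ t → indicator (owns₂? t x)) + sum (λ j → indicator (owns₁? j x)) * K
      go (no _) eq rewrite eq = z≤n
      go (yes x∈C) eq with Fin.any? (λ j → ¬? (shared₁? x j))
      ... | yes (j , own) = begin
        indicator (x ∈? C) * K                       ≡⟨ cong (λ d → indicator d * K) eq ⟩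
        1 * K
          ≤⟨ ℕ.*-monoˡ-≤ K (ℕ.≤-trans (indicator-≤ (yes x∈C) (owns₁? j x) (λ _ → x∈C , own)) (term≤sum (λ j → indicator (owns₁? j x)) j)) ⟩
        sum (λ j → indicator (owns₁? j x)) * K       ≤⟨ ℕ.m≤n+m _ _ ⟩
        sum (λ t → indicator (owns₂? t x)) + sum (λ j → indicator (owns₁? j x)) * K ∎
      -- Adding 2(c + 1) turns the left side into the number of all arcs, which then splits into
      -- edges and non-edges.
      ... | no ∄own = ℕ.≤-trans (ℕ.+-cancelˡ-≤ (suc c + suc c) _ _ (begin
        suc c + suc c + indicator (x ∈? C) * K       ≡⟨ cong (λ d → suc c + suc c + indicator d * K) eq ⟩
        suc c + suc c + 1 * K
          ≡⟨ solve 1 (λ c → con 1 :+ c :+ (con 1 :+ c) :+ con 1 :* (c :* (con 1 :+ c)) := (con 2 :+ c) :* (con 1 :+ c) :* con 1) refl c ⟩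
        l * suc c * 1                                ≡⟨ sum-const (l * suc c) 1 ⟨
        sum {l * suc c} (λ t → 1)
          ≡⟨ sum-cong-≗ (λ t → indicator-¬ (uncurry (edge? x∈C all-shared) (arc t))) ⟨
        sum (λ t → edge t + nonedge t)               ≡⟨ ∑-distrib-+ edge nonedge ⟩
        sum edge + sum nonedge                       ≤⟨ ℕ.+-mono-≤ (edge-arcs≤ x∈C all-shared) (sum-mono λ t →
                                                         indicator-≤ (¬? (uncurry (edge? x∈C all-shared) (arc t))) (owns₂? t x)
                                                           λ ¬edge → x∈C , λ shared → ¬edge (arc-distinct t , shared)) ⟩
        suc c + suc c + sum (λ t → indicator (owns₂? t x)) ∎)) (ℕ.m≤m+n _ _)
        where
        open +-*-Solver
        all-shared : ∀ j → Shared₁ x j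
        all-shared j = decidable-stable (shared₁? x j) λ own → ∄own (j , own)
        edge nonedge : Fin (l * suc c) → ℕ
        edge t = indicator (uncurry (edge? x∈C all-shared) (arc t))
        nonedge t = indicator (¬? (uncurry (edge? x∈C all-shared) (arc t)))

    -- Sum `owned` over all words and exchange the summations: each ordered pair has at most `q * q`
    -- owners, each coordinate at most `q`. The common factor `suc c` cancels.
    ∣C∣*c≤ : ∣ C ∣ * c ≤ l * (q * q) + l * c * q
    ∣C∣*c≤ = ℕ.*-cancelʳ-≤ _ _ (suc c) (begin
      ∣ C ∣ * c * suc c                                              ≡⟨ ℕ.*-assoc ∣ C ∣ c (suc c) ⟩
      ∣ C ∣ * K                                                      ≡⟨ cong (_* K) (∣p∣≡count C) ⟩
      sum (λ x → indicator (x ∈? C)) * K                             ≡⟨ sum-*ʳ (λ x → indicator (x ∈? C)) K ⟨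
      sum (λ x → indicator (x ∈? C) * K)                             ≤⟨ sum-mono owned ⟩
      sum (λ x → pairs x + singles x * K)                            ≡⟨ ∑-distrib-+ pairs (λ x → singles x * K) ⟩
      sum pairs + sum (λ x → singles x * K)                          ≡⟨ cong (sum pairs +_) (sum-*ʳ singles K) ⟩
      sum pairs + sum singles * K                                    ≡⟨ cong₂ (λ a b → a + b * K)
                                                                          (∑-comm (λ x t → indicator (owns₂? t x)))
                                                                          (∑-comm (λ x j → indicator (owns₁? j x))) ⟩
      sum (λ t → count (owns₂? t)) + sum (λ j → count (owns₁? j)) * K
        ≤⟨ ℕ.+-mono-≤ (sum-mono owns₂-≤) (ℕ.*-monoˡ-≤ K (sum-mono owns₁-≤)) ⟩
      sum {l * suc c} (λ _ → q * q) + sum {l} (λ _ → q) * K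
        ≡⟨ cong₂ (λ a b → a + b * K) (sum-const (l * suc c) (q * q)) (sum-const l q) ⟩
      l * suc c * (q * q) + l * q * K
        ≡⟨ solve 3 (λ l c q → l :* (con 1 :+ c) :* (q :* q) :+ l :* q :* (c :* (con 1 :+ c))
                                                                          := (l :* (q :* q) :+ l :* c :* q) :* (con 1 :+ c)) refl l c q ⟩
      (l * (q * q) + l * c * q) * suc c                              ∎)
      where
      open ℕ.≤-Reasoning
      open +-*-Solver
      pairs singles : Word q l → ℕ
      pairs x = sum (λ t → indicator (owns₂? t x))
      singles x = sum (λ j → indicator (owns₁? j x))

-- The lower bound: the product of an affine plane with a modular array.

module CodeLowerBound where
  open import Data.Fin.Subset using (_∈_)
  open import Data.Integer as ℤ using (ℤ; +_)
  import Data.Integer.Divisibility.Signed as ℤ∣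
  import Data.Integer.Properties as ℤ
  import Data.Integer.Solver as ℤ
  open import Data.Nat.Coprimality using (Coprime; coprime-divisor)
  open import Data.Nat.Divisibility using (_∣_; ∣⇒≤; m∣m*n; ∣-trans; m≤n⇒m!∣n!; ∣m+n∣m⇒∣n; ∣n⇒∣m*n; ∣1⇒≡1)
  open AffinePlanes using (OrthogonalArray)
  open Counting using (image; ∈-image⁺; ∈-image⁻; injective⇒≤∣p∣; pigeonhole-∈)
  open import Data.Fin using (zero; suc; punchIn; punchOut; combine; remQuot; funToFin; inject≤)
  open import Data.Nat using (_+_; _*_; _%_; _⊔_)
  open import Data.Nat.DivMod using (_mod_)
  open import Relation.Binary.PropositionalEquality using (refl; sym; trans; cong; cong₂; subst; module ≡-Reasoning)

  ∣j-i∣≢0 : ∀ {i j} → i ≢ j → ℤ.∣ + j ℤ.- + i ∣ ≢ 0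
  ∣j-i∣≢0 {i} {j} i≢j e = i≢j (sym (ℤ.+-injective (ℤ.i-j≡0⇒i≡j (+ j) (+ i) (ℤ.∣i∣≡0⇒i≡0 e))))

  ∣j-i∣<n : ∀ {i j n} → i < n → j < n → ℤ.∣ + j ℤ.- + i ∣ < n
  ∣j-i∣<n {i} {j} i<n j<n = ℕ.≤-<-trans
    (subst (λ z → ℤ.∣ z ∣ ≤ j ⊔ i) (sym (ℤ.m-n≡m⊖n j i)) (ℤ.∣m⊝n∣≤m⊔n j i)) (ℕ.⊔-lub j<n i<n)

  %≡⇒∣- : ∀ m .{{_ : NonZero m}} {a b} → a % m ≡ b % m → + m ℤ∣.∣ + a ℤ.- + b
  %≡⇒∣- m {a} {b} e = ℤ∣.divides (+ (a ℕ./ m) ℤ.- + (b ℕ./ m)) (begin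
    + a ℤ.- + b
      ≡⟨ cong₂ ℤ._-_ (split a) (split b) ⟩
    (+ (a % m) ℤ.+ + (a ℕ./ m) ℤ.* + m) ℤ.- (+ (b % m) ℤ.+ + (b ℕ./ m) ℤ.* + m)
      ≡⟨ cong (λ r → (+ r ℤ.+ + (a ℕ./ m) ℤ.* + m) ℤ.- (+ (b % m) ℤ.+ + (b ℕ./ m) ℤ.* + m)) e ⟩
    (+ (b % m) ℤ.+ + (a ℕ./ m) ℤ.* + m) ℤ.- (+ (b % m) ℤ.+ + (b ℕ./ m) ℤ.* + m)
      ≡⟨ factor (+ (b % m)) (+ (a ℕ./ m)) (+ (b ℕ./ m)) (+ m) ⟩
    (+ (a ℕ./ m) ℤ.- + (b ℕ./ m)) ℤ.* + m ∎)
    where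
    open ≡-Reasoning
    open ℤ.+-*-Solver
    factor : ∀ r x y m → (r ℤ.+ x ℤ.* m) ℤ.- (r ℤ.+ y ℤ.* m) ≡ (x ℤ.- y) ℤ.* m
    factor = solve 4 (λ r x y m → (r :+ x :* m) :- (r :+ y :* m) := (x :- y) :* m) refl
    split : ∀ a → + a ≡ + (a % m) ℤ.+ + (a ℕ./ m) ℤ.* + m
    split a = trans (cong +_ (ℕ.m≡m%n+[m/n]*n a m)) (cong (λ z → + (a % m) ℤ.+ z) (ℤ.pos-* (a ℕ./ m) m))

  ∣-⇒≡ : ∀ {m a b} → a < m → b < m → m ∣ ℤ.∣ + a ℤ.- + b ∣ → a ≡ b
  ∣-⇒≡ {m} {a} {b} a<m b<m m∣ with a ℕ.≟ b
  ... | yes a≡b = a≡b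
  ... | no a≢b = contradiction (∣⇒≤ {{ℕ.≢-nonZero (∣j-i∣≢0 (a≢b ∘ sym))}} m∣) (ℕ.<⇒≱ (∣j-i∣<n b<m a<m))

  -- The words (u + j v)_j over ℤ/m, with m prime to all differences of coordinates.
  modularArray : ∀ m .{{_ : NonZero m}} l → (∀ d → d ≢ 0 → d < l → Coprime m d) → OrthogonalArray m l
  modularArray m l coprime = word , λ {x} {y} {i} {j} → unique {x} {y} {i} {j}
    where
    value : Fin m × Fin m → Fin l → ℕ
    value (u , v) j = toℕ u + toℕ j * toℕ v
    word : Fin m × Fin m → Fin l → Fin m
    word x j = value x j mod m
    congruent : ∀ {x y} j → word x j ≡ word y j → + m ℤ∣.∣ + value x j ℤ.- + value y j
    congruent {x} {y} j e = %≡⇒∣- m (trans (sym (Fin.toℕ-fromℕ< (ℕ.m%n<n (value x j) m)))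
      (trans (cong toℕ e) (Fin.toℕ-fromℕ< (ℕ.m%n<n (value y j) m))))
    +value : ∀ u v j → + value (u , v) j ≡ + toℕ u ℤ.+ + toℕ j ℤ.* + toℕ v
    +value u v j = cong (λ z → + toℕ u ℤ.+ z) (ℤ.pos-* (toℕ j) (toℕ v))
    open ℤ.+-*-Solver
    -- Subtracting the differences at two coordinates eliminates the offsets `u` and `u′`.
    slope-difference : ∀ u v u′ v′ i j →
      (+ value (u , v) j ℤ.- + value (u′ , v′) j) ℤ.- (+ value (u , v) i ℤ.- + value (u′ , v′) i)
      ≡ (+ toℕ j ℤ.- + toℕ i) ℤ.* (+ toℕ v ℤ.- + toℕ v′)
    slope-difference u v u′ v′ i j = trans
      (cong₂ ℤ._-_ (cong₂ ℤ._-_ (+value u v j) (+value u′ v′ j)) (cong₂ ℤ._-_ (+value u v i) (+value u′ v′ i)))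
      (identity (+ toℕ u) (+ toℕ v) (+ toℕ u′) (+ toℕ v′) (+ toℕ i) (+ toℕ j))
      where
      identity : ∀ u v u′ v′ i j →
        ((u ℤ.+ j ℤ.* v) ℤ.- (u′ ℤ.+ j ℤ.* v′)) ℤ.- ((u ℤ.+ i ℤ.* v) ℤ.- (u′ ℤ.+ i ℤ.* v′))
        ≡ (j ℤ.- i) ℤ.* (v ℤ.- v′)
      identity = solve 6 (λ u v u′ v′ i j →
        ((u :+ j :* v) :- (u′ :+ j :* v′)) :- ((u :+ i :* v) :- (u′ :+ i :* v′)) := (j :- i) :* (v :- v′)) refl
    offset-difference : ∀ u u′ v i → + value (u , v) i ℤ.- + value (u′ , v) i ≡ + toℕ u ℤ.- + toℕ u′
    offset-difference u u′ v i = trans (cong₂ ℤ._-_ (+value u v i) (+value u′ v i))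
      (identity (+ toℕ u) (+ toℕ u′) (+ toℕ i ℤ.* + toℕ v))
      where
      identity : ∀ u u′ w → (u ℤ.+ w) ℤ.- (u′ ℤ.+ w) ≡ u ℤ.- u′
      identity = solve 3 (λ u u′ w → (u :+ w) :- (u′ :+ w) := u :- u′) refl
    -- `m` divides (j - i)(v - v′) and is prime to j - i, so it divides v - v′, whose absolute value
    -- is below `m`.
    slope : ∀ {u v u′ v′ i j} → i ≢ j → word (u , v) i ≡ word (u′ , v′) i → word (u , v) j ≡ word (u′ , v′) j → v ≡ v′
    slope {u} {v} {u′} {v′} {i} {j} i≢j eᵢ eⱼ = Fin.toℕ-injective (∣-⇒≡ (Fin.toℕ<n v) (Fin.toℕ<n v′)
      (coprime-divisor coprime-j-i (subst (m ∣_) (ℤ.abs-* J-I V-V′) m∣abs)))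
      where
      J-I V-V′ : ℤ
      J-I = + toℕ j ℤ.- + toℕ i
      V-V′ = + toℕ v ℤ.- + toℕ v′
      m∣product : + m ℤ∣.∣ J-I ℤ.* V-V′
      m∣product = subst (+ m ℤ∣.∣_) (slope-difference u v u′ v′ i j)
        (ℤ∣.∣m∣n⇒∣m-n (congruent {u , v} {u′ , v′} j eⱼ) (congruent {u , v} {u′ , v′} i eᵢ))
      m∣abs : m ∣ ℤ.∣ J-I ℤ.* V-V′ ∣
      m∣abs = ℤ∣.∣⇒∣ᵤ {+ m} {J-I ℤ.* V-V′} m∣product
      coprime-j-i : Coprime m ℤ.∣ J-I ∣
      coprime-j-i = coprime ℤ.∣ J-I ∣ (∣j-i∣≢0 (i≢j ∘ Fin.toℕ-injective)) (∣j-i∣<n (Fin.toℕ<n i) (Fin.toℕ<n j))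
    offset : ∀ {u u′ v i} → word (u , v) i ≡ word (u′ , v) i → u ≡ u′
    offset {u} {u′} {v} {i} eᵢ = Fin.toℕ-injective (∣-⇒≡ (Fin.toℕ<n u) (Fin.toℕ<n u′)
      (ℤ∣.∣⇒∣ᵤ {+ m} {+ toℕ u ℤ.- + toℕ u′}
        (subst (+ m ℤ∣.∣_) (offset-difference u u′ v i) (congruent {u , v} {u′ , v} i eᵢ))))
    unique : ∀ {x y i j} → i ≢ j → word x i ≡ word y i → word x j ≡ word y j → x ≡ y
    unique {u , v} {u′ , v′} {i} i≢j eᵢ eⱼ = same-slope (slope {u} {v} {u′} {v′} i≢j eᵢ eⱼ) eᵢ
      where
      same-slope : ∀ {v′} → v ≡ v′ → word (u , v) i ≡ word (u′ , v′) i → (u , v) ≡ (u′ , v′)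
      same-slope refl eᵢ = cong (_, v) (offset {u} {u′} {v} {i} eᵢ)

  -- Every such `d` divides `n !`, so a common divisor divides 1.
  coprime-1+t*n! : ∀ t n d → d ≢ 0 → d < suc n → Coprime (suc (t * n !)) d
  coprime-1+t*n! t n zero d≢0 _ _ = contradiction refl d≢0
  coprime-1+t*n! t n (suc d) _ d<1+n {e} (e∣m , e∣d) = ∣1⇒≡1 (∣m+n∣m⇒∣n
    (subst (e ∣_) (ℕ.+-comm 1 (t * n !)) e∣m)
    (∣n⇒∣m*n t (∣-trans e∣d (∣-trans (m∣m*n (d !)) (m≤n⇒m!∣n! (ℕ.≤-pred d<1+n))))))

  -- In a word of the code at least c + 1 coordinates are such that any two of them determine the
  -- word; two of these are inherited from one of the c parents.
  module _ {q l c a : ℕ} (1≤c : 1 ≤ c) (word : Fin a → Fin l → Fin q)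
    (own : Fin a → Fin (suc c) → Fin l)
    (determined : ∀ s s′ {i j} → i ≢ j → word s (own s i) ≡ word s′ (own s i) →
      word s (own s j) ≡ word s′ (own s j) → s ≡ s′)
    where

    codeword : Fin a → Word q l
    codeword s = funToFin (word s)

    coord-codeword : ∀ s i → coord q l (codeword s) i ≡ word s i
    coord-codeword s = Fin.finToFun-funToFin (word s)

    agree : ∀ s s′ i → coord q l (codeword s) i ≡ coord q l (codeword s′) i → word s i ≡ word s′ i
    agree s s′ i e = trans (sym (coord-codeword s i)) (trans e (coord-codeword s′ i))

    codeword-injective : ∀ {s s′} → codeword s ≡ codeword s′ → s ≡ s′
    codeword-injective {s} {s′} e = determined s s′ first≢second
      (agree s s′ _ (cong (λ x → coord q l x (own s first)) e)) (agree s s′ _ (cong (λ x → coord q l x (own s second)) e))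
      where
      first second : Fin (suc c)
      first = Fin.fromℕ< {0} (s≤s z≤n)
      second = Fin.fromℕ< {1} (s≤s 1≤c)
      first≢second : first ≢ second
      first≢second e = contradiction (trans (sym (Fin.toℕ-fromℕ< {0} {suc c} (s≤s z≤n)))
        (trans (cong toℕ e) (Fin.toℕ-fromℕ< (s≤s 1≤c)))) λ ()

    image-frameproof : IsFrameproof q l c (image codeword)
    image-frameproof P P⊆D ∣P∣≤c = (λ (covered , x∈D) → inherited covered (∈-image⁻ codeword x∈D)) ,
      (λ {y} y∈P → (λ i → y , y∈P , refl) , P⊆D y∈P)
      where
      inherited : ∀ {x} → desc q l P x → (∃ λ s → codeword s ≡ x) → x ∈ P
      inherited covered (s , refl) with pigeonhole-∈ P (λ i → proj₁ (covered (own s i)))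
        (λ i → proj₁ (proj₂ (covered (own s i)))) (s≤s ∣P∣≤c)
      ... | i , j , i≢j , yᵢ≡yⱼ = found (∈-image⁻ codeword (P⊆D yᵢ∈P))
        where
        yᵢ = proj₁ (covered (own s i))
        yᵢ∈P = proj₁ (proj₂ (covered (own s i)))
        found : (∃ λ s′ → codeword s′ ≡ yᵢ) → codeword s ∈ P
        found (s′ , e) = subst (_∈ P) (trans (sym e) (cong codeword (sym s≡s′))) yᵢ∈P
          where
          s≡s′ : s ≡ s′
          s≡s′ = determined s s′ i≢j
            (agree s s′ _ (trans (proj₂ (proj₂ (covered (own s i)))) (cong (λ y → coord q l y _) (sym e))))
            (agree s s′ _ (trans (proj₂ (proj₂ (covered (own s j)))) (cong (λ y → coord q l y _) (trans (sym yᵢ≡yⱼ) (sym e)))))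

    ≤M : a ≤ M c l q
    ≤M = ℕ.≤-trans (injective⇒≤∣p∣ (image codeword) codeword codeword-injective (∈-image⁺ codeword))
      (proj₂ (proj₂ (largestFrameproof q l c)) (image codeword) image-frameproof)

  module Product {c m q : ℕ} (1≤c : 1 ≤ c) (plane : OrthogonalArray (suc c) (2 + c))
    (array : OrthogonalArray m (2 + c)) (1+c*m≤q : suc (c * m) ≤ q) where

    -- One word of the plane, the base, is left out: its letter at each coordinate is replaced by a
    -- single symbol, whatever the letter of the array, so the alphabet has only c m + 1 letters.
    rest : ℕ
    rest = c + c * suc c

    private
      W = proj₁ plane
      A = proj₁ array

    -- `suc c * suc c` unfolds to `suc rest`: the base has number 0, and the remaining plane words
    -- are the successors.
    base : Fin (suc c) × Fin (suc c)
    base = remQuot (suc c) zero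

    planeWord : Fin rest → Fin (suc c) × Fin (suc c)
    planeWord s = remQuot (suc c) (Fin.suc s)

    remQuot-injective : ∀ {n k} (x y : Fin (n * k)) → remQuot {n} k x ≡ remQuot {n} k y → x ≡ y
    remQuot-injective {n} {k} x y e = trans (sym (Fin.combine-remQuot {n} k x))
      (trans (cong (uncurry combine) e) (Fin.combine-remQuot {n} k y))

    letter : ∀ (w w₀ : Fin (suc c)) → Fin m → Fin (suc (c * m))
    letter w w₀ a with w₀ Fin.≟ w
    ... | yes _ = zero
    ... | no w₀≢w = suc (combine (punchOut w₀≢w) a)

    letter-injective : ∀ {w w′ w₀ a a′} → w₀ ≢ w → letter w w₀ a ≡ letter w′ w₀ a′ → w ≡ w′ × a ≡ a′
    letter-injective {w} {w′} {w₀} {a} {a′} w₀≢w e with w₀ Fin.≟ w | w₀ Fin.≟ w′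
    ... | yes w₀≡w | _ = contradiction w₀≡w w₀≢w
    ... | no w₀≢w | no w₀≢w′ with Fin.combine-injective (punchOut w₀≢w) a (punchOut w₀≢w′) a′ (Fin.suc-injective e)
    ... | e₁ , e₂ = Fin.punchOut-injective w₀≢w w₀≢w′ e₁ , e₂

    split : Fin (rest * (m * m)) → (Fin (suc c) × Fin (suc c)) × (Fin m × Fin m)
    split s = let w , a = remQuot {rest} (m * m) s in planeWord w , remQuot m a

    split-injective : ∀ {s s′} → split s ≡ split s′ → s ≡ s′
    split-injective {s} {s′} e = remQuot-injective {rest} s s′ (cong₂ _,_
      (Fin.suc-injective (remQuot-injective {suc c} _ _ (cong proj₁ e)))
      (remQuot-injective {m} _ _ (cong proj₂ e)))

    word : Fin (rest * (m * m)) → Fin (2 + c) → Fin q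
    word s i = inject≤ (letter (W (proj₁ (split s)) i) (W base i) (A (proj₂ (split s)) i)) 1+c*m≤q

    -- Two words of the plane agree at most once, so dropping the place of agreement with the base
    -- leaves `c + 1` uncollapsed letters. If there is no agreement, coordinate zero is dropped by
    -- default.
    nonzero : ∀ s → ∃ λ i₀ → ∀ i → W base (punchIn i₀ i) ≢ W (proj₁ (split s)) (punchIn i₀ i)
    nonzero s with Fin.any? (λ i → W base i Fin.≟ W (proj₁ (split s)) i)
    ... | yes (i₀ , e₀) = i₀ , λ i e → contradiction
            (remQuot-injective {suc c} {suc c} zero (suc (proj₁ (remQuot {rest} (m * m) s))) (proj₂ plane {base} {proj₁ (split s)} (Fin.punchInᵢ≢i i₀ i ∘ sym) e₀ e)) λ ()
    ... | no none = zero , λ i e → none (_ , e)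

    -- An uncollapsed letter reveals both its plane letter and its array letter, and two coordinates
    -- determine a word of the plane and a word of the array.
    rest*m²≤M : rest * (m * m) ≤ M c (2 + c) q
    rest*m²≤M = ≤M 1≤c word (λ s → punchIn (proj₁ (nonzero s))) λ s s′ {i} {j} i≢j eᵢ eⱼ →
      let coordinate = λ k e → letter-injective (proj₂ (nonzero s) k) (Fin.inject≤-injective 1+c*m≤q 1+c*m≤q _ _ e)
          wᵢ , aᵢ = coordinate i eᵢ
          wⱼ , aⱼ = coordinate j eⱼ
          distinct = i≢j ∘ Fin.punchIn-injective (proj₁ (nonzero s)) i j
      in split-injective (cong₂ _,_ (proj₂ plane distinct wᵢ wⱼ) (proj₂ array distinct aᵢ aⱼ))

-- Rational estimates and the passage to the limit.

open import Data.Integer as ℤ using (+_)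
import Data.Integer.Properties as ℤ
import Data.Nat.Divisibility as ∣
open import Data.Rational as ℚ using (ℚ; _/_; 0ℚ; ↥_; ↧ₙ_; toℚᵘ)
import Data.Rational.Properties as ℚ
open import Data.Rational.Unnormalised as ℚᵘ using (mkℚᵘ)
import Data.Rational.Unnormalised.Properties as ℚᵘ
open AffinePlanes using (affinePlane)
open CodeLowerBound
open CodeUpperBound
open import Data.Nat using (_+_; _*_; _^_)
open import Relation.Binary.PropositionalEquality using (refl; sym; trans; cong; cong₂; subst)

∣-∣≤ : ∀ {x y e} → x ≤ y + e → y ≤ x + e → ℤ.∣ + x ℤ.- + y ∣ ≤ e
∣-∣≤ {x} {y} {e} x≤y+e y≤x+e = subst (λ z → ℤ.∣ z ∣ ≤ e) (sym (ℤ.m-n≡m⊖n x y)) bound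
  where
  bound : ℤ.∣ x ℤ.⊖ y ∣ ≤ e
  bound with ℕ.≤-total x y
  ... | inj₁ x≤y = subst (_≤ e) (sym (ℤ.∣⊖∣-≤ x≤y)) (ℕ.m≤n+o⇒m∸n≤o y x y≤x+e)
  ... | inj₂ y≤x = subst (_≤ e) (sym (trans (ℤ.∣m⊖n∣≡∣n⊖m∣ x y) (ℤ.∣⊖∣-≤ y≤x))) (ℕ.m≤n+o⇒m∸n≤o x y x≤y+e)

-- The distance is ∣a s - r b∣ / (b s), compared with `ε` by cross multiplication. Unnormalised
-- rationals keep the denominators `b` and `s` visible.
∣/-/∣< : ∀ a b r s e .{{_ : NonZero b}} .{{_ : NonZero s}} (ε : ℚ) → 0ℚ ℚ.< ε →
  a * s ≤ r * b + e → r * b ≤ a * s + e → e * ↧ₙ ε < ℤ.∣ ↥ ε ∣ * (b * s) →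
  ℚ.∣ (+ a) / b ℚ.- (+ r) / s ∣ ℚ.< ε
∣/-/∣< a b@(suc b′) r s@(suc s′) e ε 0<ε upper lower small = ℚ.toℚᵘ-cancel-<
  (ℚᵘ.<-respˡ-≃ (ℚᵘ.≃-sym difference) (ℚᵘ.*<* (begin-strict
    + ℤ.∣ + a ℤ.* + s ℤ.+ ℤ.- (+ r) ℤ.* + b ∣ ℤ.* ℚᵘ.↧ (toℚᵘ ε)
      ≡⟨ cong (λ z → + ℤ.∣ z ∣ ℤ.* ℚᵘ.↧ (toℚᵘ ε)) (cong₂ ℤ._+_ (sym (ℤ.pos-* a s))
           (trans (sym (ℤ.neg-distribˡ-* (+ r) (+ b))) (cong ℤ.-_ (sym (ℤ.pos-* r b))))) ⟩
    + ℤ.∣ + (a * s) ℤ.- + (r * b) ∣ ℤ.* ℚᵘ.↧ (toℚᵘ ε)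
      ≡⟨ cong (+ ℤ.∣ + (a * s) ℤ.- + (r * b) ∣ ℤ.*_) (ℚ.↧ᵘ-toℚᵘ ε) ⟩
    + ℤ.∣ + (a * s) ℤ.- + (r * b) ∣ ℤ.* + ↧ₙ ε
      ≡⟨ ℤ.pos-* ℤ.∣ + (a * s) ℤ.- + (r * b) ∣ (↧ₙ ε) ⟨
    + (ℤ.∣ + (a * s) ℤ.- + (r * b) ∣ * ↧ₙ ε)
      <⟨ ℤ.+<+ (ℕ.≤-<-trans (ℕ.*-monoˡ-≤ (↧ₙ ε) (∣-∣≤ {a * s} {r * b} upper lower)) small) ⟩
    + (ℤ.∣ ↥ ε ∣ * (b * s))
      ≡⟨ ℤ.pos-* ℤ.∣ ↥ ε ∣ (b * s) ⟩
    + ℤ.∣ ↥ ε ∣ ℤ.* + (b * s)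
      ≡⟨ cong (ℤ._* + (b * s)) (trans (ℤ.0≤i⇒+∣i∣≡i 0≤↥ε) (sym (ℚ.↥ᵘ-toℚᵘ ε))) ⟩
    ℚᵘ.↥ (toℚᵘ ε) ℤ.* + (b * s) ∎)))
  where
  open ℤ.≤-Reasoning
  0≤↥ε : + 0 ℤ.≤ ↥ ε
  0≤↥ε = ℤ.nonNegative⁻¹ (↥ ε) {{subst ℤ.NonNegative (ℚ.↥ᵘ-toℚᵘ ε) (ℚ.pos⇒nonNeg ε {{ℚ.positive 0<ε}})}}
  difference : toℚᵘ ℚ.∣ (+ a) / b ℚ.- (+ r) / s ∣ ℚᵘ.≃ ℚᵘ.∣ mkℚᵘ (+ a) b′ ℚᵘ.- mkℚᵘ (+ r) s′ ∣
  difference = ℚᵘ.≃-trans (ℚ.toℚᵘ-homo-∣-∣ ((+ a) / b ℚ.- (+ r) / s)) (ℚᵘ.∣-∣-cong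
    (ℚᵘ.≃-trans (ℚ.toℚᵘ-homo-+ ((+ a) / b) (ℚ.- ((+ r) / s))) (ℚᵘ.+-cong (ℚ.toℚᵘ-fromℚᵘ (mkℚᵘ (+ a) b′))
      (ℚᵘ.≃-trans (ℚ.toℚᵘ-homo‿- ((+ r) / s)) (ℚᵘ.-‿cong (ℚ.toℚᵘ-fromℚᵘ (mkℚᵘ (+ r) s′)))))))

-- The numerator 2 + c + (c - 1) is 1 + 2c, and 1 / c rounds down to 0 because `c` exceeds 1.
⌈2+c/c⌉≡2 : ∀ c .{{_ : NonZero c}} → 2 ≤ c → ⌈ 2 + c / c ⌉ ≡ 2
⌈2+c/c⌉≡2 c@(suc c′) 2≤c = trans (cong (ℕ._/ c) (solve 1 (λ k → con 2 :+ (con 1 :+ k) :+ k := con 1 :+ con 2 :* (con 1 :+ k)) refl c′))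
  (trans (ℕ.+-distrib-/-∣ʳ 1 {2 * c} {c} (∣.n∣m*n 2)) (cong₂ _+_ (ℕ.m<n⇒m/n≡0 2≤c) (ℕ.m*n/n≡m 2 c)))
  where open +-*-Solver

module Bounds (c : ℕ) .{{_ : NonZero c}} (2≤c : 2 ≤ c) (primePower : IsPrimePower (suc c)) where

  -- `G` is the step of `c * m` as `m` runs through the numbers congruent to 1 modulo `F`. `B * q`
  -- is an error term that serves both bounds.
  l F G B : ℕ
  l = 2 + c
  F = suc c !
  G = c * F
  B = l * (2 * G)

  instance
    F≢0 : NonZero F
    F≢0 = suc c ℕ.!≢0
    G≢0 : NonZero G
    G≢0 = ℕ.m*n≢0 c F

  upper : ∀ q → M c l q * c ≤ l * (q * q) + B * q
  upper q = ℕ.≤-trans (UpperBound.∣C∣*c≤ q c 2≤c _ (proj₁ (proj₂ (largestFrameproof q l c))))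
    (ℕ.+-monoʳ-≤ (l * (q * q)) (ℕ.*-monoˡ-≤ q (ℕ.*-monoʳ-≤ l (ℕ.≤-trans (ℕ.m≤m*n c F) (ℕ.m≤m+n G _)))))

  -- The modulus is the largest m ≡ 1 (mod (c+1)!) with c m + 1 ≤ q.
  lower : ∀ q → suc c ≤ q → l * (q * q) ≤ M c l q * c + B * q
  lower q 1+c≤q = begin
    -- The two factors `q` are replaced by `c * m + G` one after the other. Besides the square of
    -- `c * m` this leaves errors of at most `2 * G * q`.
    l * (q * q)                                    ≤⟨ ℕ.*-monoʳ-≤ l (ℕ.*-monoʳ-≤ q q≤cm+G) ⟩
    l * (q * (c * m + G))
      ≡⟨ solve 4 (λ l q x g → l :* (q :* (x :+ g)) := l :* (q :* x) :+ l :* (q :* g)) refl l q (c * m) G ⟩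
    l * (q * (c * m)) + l * (q * G)                ≤⟨ ℕ.+-monoˡ-≤ _ (ℕ.*-monoʳ-≤ l (ℕ.*-monoˡ-≤ (c * m) q≤cm+G)) ⟩
    l * ((c * m + G) * (c * m)) + l * (q * G)
      ≡⟨ solve 4 (λ l q x g → l :* ((x :+ g) :* x) :+ l :* (q :* g) := l :* (x :* x) :+ l :* (g :* x :+ g :* q)) refl l q (c * m) G ⟩
    l * (c * m * (c * m)) + l * (G * (c * m) + G * q)
      ≤⟨ ℕ.+-mono-≤ main (ℕ.*-monoʳ-≤ l (ℕ.+-monoˡ-≤ _ (ℕ.*-monoʳ-≤ G (ℕ.≤-trans (ℕ.n≤1+n _) 1+cm≤q)))) ⟩
    M c l q * c + l * (G * q + G * q)
      ≡⟨ cong (_+_ (M c l q * c)) (solve 3 (λ l g q → l :* (g :* q :+ g :* q) := l :* (con 2 :* g) :* q) refl l G q) ⟩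
    M c l q * c + B * q                            ∎
    where
    open ℕ.≤-Reasoning
    open +-*-Solver
    r t m : ℕ
    -- Since c m + 1 = c + 1 + t G, the largest admissible `t` is the quotient of q - (c + 1) by
    -- `G`.
    r = q ∸ suc c
    t = r ℕ./ G
    m = suc (t * F)
    q≡ : q ≡ suc c + r
    q≡ = sym (ℕ.m+[n∸m]≡n 1+c≤q)
    cm≡ : c * m ≡ c + t * G
    cm≡ = solve 3 (λ c t f → c :* (con 1 :+ t :* f) := c :+ t :* (c :* f)) refl c t F
    1+cm≤q : suc (c * m) ≤ q
    1+cm≤q = begin
      suc (c * m)       ≡⟨ cong suc cm≡ ⟩
      suc c + t * G     ≤⟨ ℕ.+-monoʳ-≤ (suc c) (ℕ.m/n*n≤m r G) ⟩
      suc c + r         ≡⟨ q≡ ⟨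
      q                 ∎
    q≤cm+G : q ≤ c * m + G
    q≤cm+G = begin
      q                              ≡⟨ q≡ ⟩
      suc c + r                      ≡⟨ cong (λ x → suc c + x) (ℕ.m≡m%n+[m/n]*n r G) ⟩
      suc c + (r ℕ.% G + t * G)
        ≡⟨ solve 3 (λ c r x → con 1 :+ c :+ (r :+ x) := c :+ x :+ (con 1 :+ r)) refl c (r ℕ.% G) (t * G) ⟩
      c + t * G + suc (r ℕ.% G)      ≤⟨ ℕ.+-monoʳ-≤ (c + t * G) (ℕ.m%n<n r G) ⟩
      c + t * G + G                  ≡⟨ cong (_+ G) cm≡ ⟨
      c * m + G                      ∎
    main : l * (c * m * (c * m)) ≤ M c l q * c
    main = begin
      l * (c * m * (c * m))
        ≡⟨ solve 2 (λ c m → (con 2 :+ c) :* (c :* m :* (c :* m)) := (c :+ c :* (con 1 :+ c)) :* (m :* m) :* c) refl c m ⟩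
      (c + c * suc c) * (m * m) * c
        ≤⟨ ℕ.*-monoˡ-≤ c (Product.rest*m²≤M (ℕ.≤-trans (s≤s z≤n) 2≤c) (affinePlane primePower)
                                                 (modularArray m l (λ d d≢0 d<l → coprime-1+t*n! t (suc c) d d≢0 d<l)) 1+cm≤q) ⟩
      M c l q * c                           ∎

  converges : IsR c l ((+ l) / c)
  -- The first summand of the threshold makes `lower` applicable; the second brings the error B / (c
  -- q) below 1 / `↧ₙ ε`, which is at most `ε`.
  converges ε 0<ε = suc c + suc (B * ↧ₙ ε) , λ q N≤q → ∣/-/∣< (M c l q) (q ^ ⌈ l / c ⌉) l c (B * q) {{ℕ.m^n≢0 q ⌈ l / c ⌉}} ε 0<ε
    (subst (λ b → M c l q * c ≤ l * b + B * q) (sym (square q)) (upper q))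
    (subst (λ b → l * b ≤ M c l q * c + B * q) (sym (square q)) (lower q (ℕ.≤-trans (ℕ.m≤m+n (suc c) _) N≤q)))
    (subst (λ b → B * q * ↧ₙ ε < ℤ.∣ ↥ ε ∣ * (b * c)) (sym (square q)) (small q (ℕ.≤-trans (ℕ.m≤n+m _ (suc c)) N≤q)))
    where
    square : ∀ q → q ^ ⌈ l / c ⌉ ≡ q * q
    square q = trans (cong (q ^_) (⌈2+c/c⌉≡2 c 2≤c)) (cong (q *_) (ℕ.*-identityʳ q))
    instance
      ↥ε≢0 : NonZero ℤ.∣ ↥ ε ∣
      ↥ε≢0 = subst (λ i → NonZero ℤ.∣ i ∣) (ℚ.↥ᵘ-toℚᵘ ε) (ℚ.pos⇒nonZero ε {{ℚ.positive 0<ε}})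
    open ℕ.≤-Reasoning
    small : ∀ q .{{_ : NonZero q}} → B * ↧ₙ ε < q → B * q * ↧ₙ ε < ℤ.∣ ↥ ε ∣ * (q * q * c)
    small q Bd<q = begin-strict
      B * q * ↧ₙ ε                   ≡⟨ solve 3 (λ b q d → b :* q :* d := b :* d :* q) refl B q (↧ₙ ε) ⟩
      B * ↧ₙ ε * q                   <⟨ ℕ.*-monoˡ-< q Bd<q ⟩
      q * q                          ≤⟨ ℕ.m≤m*n (q * q) c ⟩
      q * q * c                      ≤⟨ ℕ.m≤n*m (q * q * c) ℤ.∣ ↥ ε ∣ ⟩
      ℤ.∣ ↥ ε ∣ * (q * q * c)        ∎
      where open +-*-Solver

theorem4 : (c : ℕ) .{{_ : NonZero c}} → 2 ≤ c → IsPrimePower (c + 1) →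
    IsR c (c + 2) ((+ (c + 2)) / c)
theorem4 c 2≤c primePower = subst (λ l → IsR c l ((+ l) / c)) (ℕ.+-comm 2 c)
  (Bounds.converges c 2≤c (subst IsPrimePower (ℕ.+-comm c 1) primePower))
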